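{- Let $\pi=(d_{1},\ldots,d_{n})$ be a non-increasing graphic sequence. Let $k\leq d_{n}$ be a non-negative integer such that $kn$ is even. If $$d_{d_{1}-d_{n}+1}\geq d_{1}-d_{n}+k-1,$$ then some realization of $\pi$ has a $k$-factor.
   Context: A sequence of non-negative integers is graphic if it is the degree sequence of some finite simple graph, called a realization of it. A $k$-factor of a graph is a $k$-regular spanning subgraph. -}

module Defs where

open import Data.Nat using (ℕ; zero; suc; _≤_)
open import Data.Bool using (Bool; true; false; T)
open import Data.Fin using (Fin) renaming (_≤_ to _≤ᶠ_)
open import Data.Bool.Properties using (T?)
open import Data.List using (List; length; filter; allFin)
open import Data.Product using (Σ; _×_)
open import Relation.Binary.PropositionalEquality using (_≡_)
open import Relation.Nullary using (¬_)

record Graph (n : ℕ) : Set where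
  field
    adj   : Fin n → Fin n → Bool
    sym   : ∀ u v → adj u v ≡ adj v u
    irrefl : ∀ v → adj v v ≡ false
open Graph public

degree : ∀ {n} → Graph n → Fin n → ℕ
degree G v = length (filter (λ u → T? (adj G v u)) (allFin _))

Realizes : ∀ {n} → Graph n → (Fin n → ℕ) → Set
Realizes G d = ∀ v → degree G v ≡ d v

Graphic : ∀ {n} → (Fin n → ℕ) → Set
Graphic {n} d = Σ (Graph n) λ G → Realizes G d

SpanningSubgraph : ∀ {n} → Graph n → Graph n → Set
SpanningSubgraph H G = ∀ u v → T (adj H u v) → T (adj G u v)

Regular : ∀ {n} → ℕ → Graph n → Set
Regular k H = ∀ v → degree H v ≡ k

HasFactor : ∀ {n} → ℕ → Graph n → Set
HasFactor {n} k G = Σ (Graph n) λ H → SpanningSubgraph H G × Regular k H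

NonIncreasing : ∀ {n} → (Fin n → ℕ) → Set
NonIncreasing {n} d = ∀ (i j : Fin n) → i ≤ᶠ j → d j ≤ d i

{-# OPTIONS --safe #-}
module Submission where

-- Put e = d − k. The Erdős–Gallai inequalities for d, together with the
-- hypothesis on the vertex d₁ − dₙ + 1, give those for e (with one borderline
-- case excluded by parity), so e is graphic by the construction of Tripathi,
-- Venugopalan and West. Then, following Chen's proof of Kundu's theorem, among
-- realizations A of d and B of e on the same vertices one with fewest edges in
-- B ∖ A has none: an edge of B ∖ A at a vertex of maximal (B ∖ A)-degree allows
-- a 2-switch in A or in B that shrinks B ∖ A. Hence A ∖ B is a k-factor of A.

open import Defs hiding (sym)
open import Data.Nat
open import Data.Nat.Properties
open import Data.Nat.Divisibility using (_∣_; divides; ∣m∣n⇒∣m+n; ∣m+n∣m⇒∣n; ∣1⇒≡1; m∣m*n)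
open import Data.Nat.Induction using (<-wellFounded)
open import Data.Nat.Tactic.RingSolver using (solve-∀)
open import Data.Bool using (Bool; true; false; T; if_then_else_; _∧_; _∨_; not) renaming (_≟_ to _≟ᵇ_)
open import Data.Bool.Properties using (T?; ∨-comm)
open import Data.Empty using (⊥; ⊥-elim)
open import Data.Fin using (Fin; zero; suc; toℕ; fromℕ; fromℕ<)
import Data.Fin.Properties as Fin
open import Data.List using (length; filter; tabulate)
open import Data.Product using (Σ; ∃; ∃₂; _×_; _,_; proj₁; proj₂)
open import Data.Sum using (_⊎_; inj₁; inj₂)
open import Function using (_∘_; id)
open import Induction.WellFounded using (Acc; acc)
open import Relation.Binary.PropositionalEquality
open import Relation.Nullary using (¬_; Dec; yes; no; does; contradiction; _×-dec_; _⊎-dec_; ¬?)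
open import Relation.Nullary.Decidable using (dec-true; dec-false)
open import Algebra.Properties.Semiring.Sum +-*-semiring
  using (sum; sum-cong-≗; ∑-distrib-+; ∑-comm; *-distribˡ-sum; *-distribʳ-sum)

-- Subtracting k lowers the left side of the inequality at t by tk, and the right side by at most k
-- for each later value of e below t. So the inequality can only break when more than t later values
-- are below t. In that range their number is itself an asset: each is at least c = min e, while the
-- left side is controlled by max e = c + r, where r = d₁ - dₙ. For c < t ≤ r the balance is
-- favourable once the first r + 1 positions hold values of at least t, and this is the origin of
-- the position r + 1 in the hypothesis. The value r - 1 of e granted there serves every t < r. At t
-- = r it can be one short, and the evenness of the sum of e, which comes from that of kn, makes up
-- for this unit. In the second half, the degrees in A ∖ B and B ∖ A differ by the constant k, so a
-- single vertex is maximal for both.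

𝟙 : Bool → ℕ
𝟙 true  = 1
𝟙 false = 0

δ : ∀ {n} → Fin n → Fin n → ℕ
δ x y = 𝟙 (does (x Fin.≟ y))

-- Finite sums and unit vectors.

sum-mono-≤ : ∀ {n} {f g : Fin n → ℕ} → (∀ i → f i ≤ g i) → sum f ≤ sum g
sum-mono-≤ {zero}  f≤g = z≤n
sum-mono-≤ {suc n} f≤g = +-mono-≤ (f≤g zero) (sum-mono-≤ (f≤g ∘ suc))

sum-mono-< : ∀ {n} {f g : Fin n → ℕ} → (∀ i → f i ≤ g i) → ∀ j → f j < g j → sum f < sum g
sum-mono-< f≤g zero    fj<gj = +-mono-<-≤ fj<gj (sum-mono-≤ (f≤g ∘ suc))
sum-mono-< f≤g (suc j) fj<gj = +-mono-≤-< (f≤g zero) (sum-mono-< (f≤g ∘ suc) j fj<gj)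

sum-const : ∀ n c → sum {n} (λ _ → c) ≡ n * c
sum-const zero    c = refl
sum-const (suc n) c = cong (c +_) (sum-const n c)

sum-positive : ∀ {n} (f : Fin n → ℕ) → 0 < sum f → ∃ λ i → 0 < f i
sum-positive {suc n} f 0<Σ with f zero in f₀
... | suc _ = zero , subst (0 <_) (sym f₀) z<s
... | zero  with sum-positive (f ∘ suc) 0<Σ
...   | i , 0<fi = suc i , 0<fi

term≤sum : ∀ {n} (f : Fin n → ℕ) i → f i ≤ sum f
term≤sum f zero    = m≤m+n _ _
term≤sum f (suc i) = ≤-trans (term≤sum (f ∘ suc) i) (m≤n+m _ _)

sum-δ* : ∀ {n} (x : Fin n) (f : Fin n → ℕ) → sum (λ q → δ x q * f q) ≡ f x
sum-δ* {suc n} zero    f rewrite sum-const n 0 | *-zeroʳ n = trans (+-identityʳ _) (+-identityʳ _)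
sum-δ* {suc n} (suc x) f = sum-δ* x (f ∘ suc)

sum-δ : ∀ {n} (x : Fin n) → sum (δ x) ≡ 1
sum-δ x = trans (sum-cong-≗ (λ q → sym (*-identityʳ (δ x q)))) (sum-δ* x (λ _ → 1))

δ-refl : ∀ {n} (x : Fin n) → δ x x ≡ 1
δ-refl x with x Fin.≟ x
... | yes _  = refl
... | no x≢x = contradiction refl x≢x

δ-≢ : ∀ {n} {x y : Fin n} → x ≢ y → δ x y ≡ 0
δ-≢ {x = x} {y} x≢y with x Fin.≟ y
... | yes x≡y = contradiction x≡y x≢y
... | no _    = refl

argmax : ∀ {n} (f : Fin (suc n) → ℕ) → ∃ λ i → ∀ j → f j ≤ f i
argmax {zero}  f = zero , λ { zero → ≤-refl }
argmax {suc n} f with argmax (f ∘ suc)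
... | i , max with ≤-total (f zero) (f (suc i))
...   | inj₁ f₀≤ = suc i , λ { zero → f₀≤ ; (suc j) → max j }
...   | inj₂ ≤f₀ = zero , λ { zero → ≤-refl ; (suc j) → ≤-trans (max j) ≤f₀ }

-- Row 0 and column 0 agree off the diagonal, so removing them removes twice `row`; the rest is a
-- smaller instance.
sum-symmetric-even : ∀ {n} (f : Fin n → Fin n → ℕ) → (∀ u v → f u v ≡ f v u) → (∀ v → f v v ≡ 0) →
  2 ∣ sum (λ u → sum (f u))
sum-symmetric-even {zero}  f f-sym f-diag = divides 0 refl
sum-symmetric-even {suc n} f f-sym f-diag =
  subst (2 ∣_) eq (∣m∣n⇒∣m+n (divides row refl) (sum-symmetric-even inner (λ u v → f-sym _ _) (f-diag ∘ suc)))
  where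
  inner : Fin n → Fin n → ℕ
  inner u v = f (suc u) (suc v)
  row = sum (λ v → f zero (suc v))
  rest = sum (λ u → sum (inner u))
  arith : ∀ a b → a * 2 + b ≡ 0 + a + (a + b)
  arith = solve-∀
  eq : row * 2 + rest ≡ sum (λ u → sum (f u))
  eq = begin
    row * 2 + rest                                       ≡⟨ arith row rest ⟩
    0 + row + (row + rest)                               ≡⟨ cong₂ (λ a b → a + row + (b + rest)) (sym (f-diag zero)) (sum-cong-≗ (λ v → f-sym zero (suc v))) ⟩
    f zero zero + row + (sum (λ u → f (suc u) zero) + rest) ≡⟨ cong (f zero zero + row +_) (∑-distrib-+ (λ u → f (suc u) zero) (λ u → sum (inner u))) ⟨
    sum (λ u → sum (f u))                                ∎
    where open ≡-Reasoning

-- Degrees as sums of indicators.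

deg : ∀ {n} → Graph n → Fin n → ℕ
deg G v = sum (λ u → 𝟙 (adj G v u))

length-filter-tabulate : ∀ {n} {A : Set} (p : A → Bool) (f : Fin n → A) →
  length (filter (T? ∘ p) (tabulate f)) ≡ sum (λ i → 𝟙 (p (f i)))
length-filter-tabulate {zero}  p f = refl
length-filter-tabulate {suc n} p f with p (f zero)
... | true  = cong suc (length-filter-tabulate p (f ∘ suc))
... | false = length-filter-tabulate p (f ∘ suc)

-- Passes from the filtered lists of the statement to sums, where all the counting takes place.
degree≡deg : ∀ {n} (G : Graph n) v → degree G v ≡ deg G v
degree≡deg G v = length-filter-tabulate (adj G v) id

handshake : ∀ {n} (G : Graph n) → 2 ∣ sum (deg G)
handshake G = sum-symmetric-even (λ u v → 𝟙 (adj G u v)) (λ u v → cong 𝟙 (Graph.sym G u v)) (λ v → cong 𝟙 (irrefl G v))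

adj⇒≢ : ∀ {n} (G : Graph n) {u v} → adj G u v ≡ true → u ≢ v
adj⇒≢ G {u} uv refl with trans (sym (irrefl G u)) uv
... | ()

true≢false : ∀ {b : Bool} → b ≡ true → b ≡ false → ⊥
true≢false refl ()

¬true⇒false : ∀ {b : Bool} → b ≢ true → b ≡ false
¬true⇒false {true}  b≢true = contradiction refl b≢true
¬true⇒false {false} _      = refl

¬false⇒true : ∀ {b : Bool} → b ≢ false → b ≡ true
¬false⇒true {true}  _       = refl
¬false⇒true {false} b≢false = contradiction refl b≢false

adj-sym : ∀ {n} (G : Graph n) {u v b} → adj G u v ≡ b → adj G v u ≡ b
adj-sym G {u} {v} uv = trans (Graph.sym G v u) uv

-- Setting one edge, and rotating an edge about one of its ends.

Same : ∀ {n} → (x y p q : Fin n) → Set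
Same x y p q = (x ≡ p × y ≡ q) ⊎ (x ≡ q × y ≡ p)

same? : ∀ {n} (x y p q : Fin n) → Dec (Same x y p q)
same? x y p q = (x Fin.≟ p ×-dec y Fin.≟ q) ⊎-dec (x Fin.≟ q ×-dec y Fin.≟ p)

Same-adj : ∀ {n} (G : Graph n) {x y p q} → Same x y p q → adj G p q ≡ adj G x y
Same-adj G (inj₁ (refl , refl)) = refl
Same-adj G (inj₂ (refl , refl)) = Graph.sym G _ _

module _ {n} (b : Bool) (G : Graph n) {x y : Fin n} (x≢y : x ≢ y) where

  setEdge : Graph n
  adj setEdge p q = if does (same? x y p q) then b else adj G p q
  Graph.sym setEdge p q
    rewrite ∨-comm (does (x Fin.≟ p) ∧ does (y Fin.≟ q)) (does (x Fin.≟ q) ∧ does (y Fin.≟ p))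
          | Graph.sym G p q = refl
  irrefl setEdge p = trans (cong (if_then b else adj G p p) (dec-false (same? x y p p) loop)) (irrefl G p)
    where
    loop : ¬ Same x y p p
    loop (inj₁ (x≡p , y≡p)) = x≢y (trans x≡p (sym y≡p))
    loop (inj₂ (x≡p , y≡p)) = x≢y (trans x≡p (sym y≡p))

  setEdge-same : ∀ {p q} → Same x y p q → adj setEdge p q ≡ b
  setEdge-same {p} {q} s = cong (if_then b else adj G p q) (dec-true (same? x y p q) s)

  setEdge-other : ∀ {p q} → ¬ Same x y p q → adj setEdge p q ≡ adj G p q
  setEdge-other {p} {q} ¬s = cong (if_then b else adj G p q) (dec-false (same? x y p q) ¬s)

  private
    -- The indicator that pq and xy are the same unordered pair; the two products are never both 1,
    -- because x ≢ y.
    ends : Fin n → Fin n → ℕ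
    ends p q = δ x p * δ y q + δ y p * δ x q

    sum-ends : ∀ p → sum (ends p) ≡ δ x p + δ y p
    sum-ends p = begin
      sum (ends p)                                             ≡⟨ ∑-distrib-+ (λ q → δ x p * δ y q) (λ q → δ y p * δ x q) ⟩
      sum (λ q → δ x p * δ y q) + sum (λ q → δ y p * δ x q)    ≡⟨ cong₂ _+_ (*-distribˡ-sum (δ x p) (δ y)) (*-distribˡ-sum (δ y p) (δ x)) ⟨
      δ x p * sum (δ y) + δ y p * sum (δ x)                    ≡⟨ cong₂ (λ a b → δ x p * a + δ y p * b) (sum-δ y) (sum-δ x) ⟩
      δ x p * 1 + δ y p * 1                                    ≡⟨ cong₂ _+_ (*-identityʳ (δ x p)) (*-identityʳ (δ y p)) ⟩
      δ x p + δ y p                                            ∎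
      where open ≡-Reasoning

    pointwise : ∀ p q → 𝟙 (adj setEdge p q) + ends p q * 𝟙 (adj G x y) ≡ 𝟙 (adj G p q) + ends p q * 𝟙 b
    pointwise p q with x Fin.≟ p | y Fin.≟ q | x Fin.≟ q | y Fin.≟ p
    ... | yes refl | yes refl | no _ | no _
          rewrite +-identityʳ (𝟙 b) | +-identityʳ (𝟙 (adj G x y)) = +-comm (𝟙 b) _
    ... | no _ | no _ | yes refl | yes refl
          rewrite +-identityʳ (𝟙 b) | +-identityʳ (𝟙 (adj G x y)) | Graph.sym G x y = +-comm (𝟙 b) _
    ... | yes refl | _ | yes refl | yes refl = contradiction refl x≢y
    ... | yes refl | _ | no _     | yes refl = contradiction refl x≢y
    ... | _ | yes refl | yes refl | _ = contradiction refl x≢y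
    ... | yes _ | no _ | yes _ | no _ = refl
    ... | yes _ | no _ | no _  | no _ = refl
    ... | no _ | yes _ | no _ | yes _ = refl
    ... | no _ | yes _ | no _ | no _  = refl
    ... | no _ | no _ | yes _ | no _  = refl
    ... | no _ | no _ | no _ | yes _  = refl
    ... | no _ | no _ | no _ | no _   = refl

  -- The old value of the pair is added to the new degree and the new value to the old degree, so
  -- that one identity covers insertion and deletion without subtraction.
  deg-setEdge : ∀ p → deg setEdge p + (δ x p + δ y p) * 𝟙 (adj G x y) ≡ deg G p + (δ x p + δ y p) * 𝟙 b
  deg-setEdge p = begin
    deg setEdge p + (δ x p + δ y p) * 𝟙 (adj G x y)     ≡⟨ spread (adj setEdge p) (𝟙 (adj G x y)) ⟨
    sum (λ q → 𝟙 (adj setEdge p q) + ends p q * 𝟙 (adj G x y)) ≡⟨ sum-cong-≗ (pointwise p) ⟩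
    sum (λ q → 𝟙 (adj G p q) + ends p q * 𝟙 b)          ≡⟨ spread (adj G p) (𝟙 b) ⟩
    deg G p + (δ x p + δ y p) * 𝟙 b                     ∎
    where
    open ≡-Reasoning
    spread : (row : Fin n → Bool) (c : ℕ) → sum (λ q → 𝟙 (row q) + ends p q * c) ≡ sum (λ q → 𝟙 (row q)) + (δ x p + δ y p) * c
    spread row c = trans (∑-distrib-+ (𝟙 ∘ row) (λ q → ends p q * c))
      (cong (sum (𝟙 ∘ row) +_) (trans (sym (*-distribʳ-sum c (ends p))) (cong (_* c) (sum-ends p))))

module _ {n} (G : Graph n) {x y : Fin n} where

  addEdge : x ≢ y → Graph n
  addEdge = setEdge true G

  delEdge : x ≢ y → Graph n
  delEdge = setEdge false G

  deg-addEdge : (x≢y : x ≢ y) → adj G x y ≡ false → ∀ p → deg (addEdge x≢y) p ≡ deg G p + (δ x p + δ y p)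
  deg-addEdge x≢y xy p with eq ← deg-setEdge true G x≢y p rewrite xy | *-zeroʳ (δ x p + δ y p) | *-identityʳ (δ x p + δ y p) =
    trans (sym (+-identityʳ _)) eq

  deg-delEdge : (x≢y : x ≢ y) → adj G x y ≡ true → ∀ p → deg (delEdge x≢y) p + (δ x p + δ y p) ≡ deg G p
  deg-delEdge x≢y xy p with eq ← deg-setEdge false G x≢y p rewrite xy | *-zeroʳ (δ x p + δ y p) | *-identityʳ (δ x p + δ y p) =
    trans eq (+-identityʳ _)

-- The edge ui is turned about `u` into ur: `u` keeps its degree and one unit passes from `i` to
-- `r`. Every larger edit below is built from such moves.
record Rotation {n} (G : Graph n) (u i r : Fin n) : Set where
  field
    graph   : Graph n
    deg-rot : ∀ p → deg graph p + δ i p ≡ deg G p + δ r p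
    removed : adj graph u i ≡ false
    added   : adj graph u r ≡ true
    other   : ∀ {p q} → ¬ Same u i p q → ¬ Same u r p q → adj graph p q ≡ adj G p q

  gain : ∀ {p q} → adj graph p q ≡ true → adj G p q ≡ true ⊎ Same u r p q
  gain {p} {q} pq with same? u r p q | same? u i p q
  ... | yes s | _     = inj₂ s
  ... | no ¬s | no ¬t = inj₁ (trans (sym (other ¬t ¬s)) pq)
  ... | no ¬s | yes t = ⊥-elim (true≢false pq (trans (Same-adj graph t) removed))

  loss : ∀ {p q} → adj G p q ≡ true → adj graph p q ≡ true ⊎ Same u i p q
  loss {p} {q} pq with same? u i p q | same? u r p q
  ... | yes s | _     = inj₂ s
  ... | no ¬s | no ¬t = inj₁ (trans (other ¬s ¬t) pq)
  ... | no ¬s | yes t = inj₁ (trans (Same-adj graph t) added)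

  off-centre : ∀ {p q} → p ≢ u → q ≢ u → adj graph p q ≡ adj G p q
  off-centre p≢u q≢u = other
    (λ { (inj₁ (u≡p , _)) → p≢u (sym u≡p) ; (inj₂ (u≡q , _)) → q≢u (sym u≡q) })
    (λ { (inj₁ (u≡p , _)) → p≢u (sym u≡p) ; (inj₂ (u≡q , _)) → q≢u (sym u≡q) })

rotate : ∀ {n} (G : Graph n) {u i r : Fin n} → adj G i u ≡ true → adj G r u ≡ false → u ≢ r → i ≢ r →
  Rotation G u i r
rotate {n} G {u} {i} {r} iu ru u≢r i≢r = record
  { graph   = H₂
  ; deg-rot = λ p → degrees (deg H₂ p) (deg G p) (δ u p) (δ i p) (δ r p) (deg H₁ p)
                      (deg-addEdge H₁ u≢r H₁-ur p) (deg-delEdge G u≢i (adj-sym G iu) p)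
  ; removed = trans (setEdge-other true H₁ u≢r (λ { (inj₁ (_ , r≡i)) → i≢r (sym r≡i) ; (inj₂ (u≡i , _)) → u≢i u≡i }))
                    (setEdge-same false G u≢i (inj₁ (refl , refl)))
  ; added   = setEdge-same true H₁ u≢r (inj₁ (refl , refl))
  ; other   = λ ¬ui ¬ur → trans (setEdge-other true H₁ u≢r ¬ur) (setEdge-other false G u≢i ¬ui)
  }
  where
  u≢i : u ≢ i
  u≢i = adj⇒≢ G (adj-sym G iu)
  H₁ H₂ : Graph n
  H₁ = delEdge G u≢i
  H₁-ur : adj H₁ u r ≡ false
  H₁-ur = trans (setEdge-other false G u≢i (λ { (inj₁ (_ , i≡r)) → i≢r i≡r ; (inj₂ (u≡r , _)) → u≢r u≡r })) (adj-sym G ru)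
  H₂ = addEdge H₁ u≢r
  degrees : ∀ h₂ g a b c h₁ → h₂ ≡ h₁ + (a + c) → h₁ + (a + b) ≡ g → h₂ + b ≡ g + c
  degrees _ _ a b c h₁ refl refl = arith h₁ a b c
    where
    arith : ∀ h₁ a b c → h₁ + (a + c) + b ≡ h₁ + (a + b) + c
    arith = solve-∀

-- The edge ir, if present, adds one to both degrees, so the inequality persists
-- for the neighbourhoods outside {i , r}.
exchange-vertex : ∀ {n} (G : Graph n) {i r : Fin n} → i ≢ r → deg G r < deg G i →
  ∃ λ u → adj G i u ≡ true × adj G r u ≡ false × u ≢ r
exchange-vertex {n} G {i} {r} i≢r r<i
  with Fin.any? (λ u → (adj G i u ≟ᵇ true) ×-dec (adj G r u ≟ᵇ false) ×-dec ¬? (u Fin.≟ r))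
... | yes found = found
... | no none = contradiction r<i (≤⇒≯ (+-cancelʳ-≤ (𝟙 (adj G i r)) _ _ i≤r))
  where
  open ≤-Reasoning
  pointwise : ∀ u → 𝟙 (adj G i u) + δ i u * 𝟙 (adj G i r) ≤ 𝟙 (adj G r u) + δ r u * 𝟙 (adj G i r)
  pointwise u with i Fin.≟ u | r Fin.≟ u
  ... | yes refl | yes refl = contradiction refl i≢r
  ... | yes refl | no _ rewrite irrefl G i | Graph.sym G i r = ≤-refl
  ... | no _ | yes refl rewrite irrefl G r = ≤-refl
  ... | no _ | no r≢u with adj G i u in iu | adj G r u in ru
  ...   | false | _     = z≤n
  ...   | true  | true  = ≤-refl
  ...   | true  | false = contradiction (u , iu , ru , r≢u ∘ sym) none
  total : ∀ (v w : Fin n) → sum (λ u → 𝟙 (adj G v u) + δ w u * 𝟙 (adj G i r)) ≡ deg G v + 𝟙 (adj G i r)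
  total v w = trans (∑-distrib-+ (𝟙 ∘ adj G v) (λ u → δ w u * 𝟙 (adj G i r))) (cong (deg G v +_) (sum-δ* w (λ _ → 𝟙 (adj G i r))))
  i≤r : deg G i + 𝟙 (adj G i r) ≤ deg G r + 𝟙 (adj G i r)
  i≤r = begin
    deg G i + 𝟙 (adj G i r)                                 ≡⟨ total i i ⟨
    sum (λ u → 𝟙 (adj G i u) + δ i u * 𝟙 (adj G i r))       ≤⟨ sum-mono-≤ pointwise ⟩
    sum (λ u → 𝟙 (adj G r u) + δ r u * 𝟙 (adj G i r))       ≡⟨ total r r ⟩
    deg G r + 𝟙 (adj G i r)                                 ∎

-- The Erdős-Gallai inequality: necessity and the case of equality.

lo hi : ∀ {n} → ℕ → Fin n → ℕ
lo t i = 𝟙 (toℕ i <ᵇ t)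
hi t i = 𝟙 (not (toℕ i <ᵇ t))

data Position {n} (t : ℕ) (i : Fin n) : Set where
  below : toℕ i < t → lo t i ≡ 1 → hi t i ≡ 0 → Position t i
  above : t ≤ toℕ i → lo t i ≡ 0 → hi t i ≡ 1 → Position t i

position : ∀ {n} t (i : Fin n) → Position t i
position t i with toℕ i <ᵇ t in eq
... | true  = below (<ᵇ⇒< (toℕ i) t (subst T (sym eq) _)) (cong 𝟙 eq) (cong (𝟙 ∘ not) eq)
... | false = above (≮⇒≥ (subst T eq ∘ <⇒<ᵇ)) (cong 𝟙 eq) (cong (𝟙 ∘ not) eq)

lo+hi : ∀ {n} t (i : Fin n) → lo t i + hi t i ≡ 1
lo+hi t i with toℕ i <ᵇ t
... | true  = refl
... | false = refl

sum-lo : ∀ {n} t → t ≤ n → sum {n} (lo t) ≡ t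
sum-lo {zero}  zero    _         = refl
sum-lo {suc n} zero    _         = sum-lo {n} zero z≤n
sum-lo {suc n} (suc t) (s≤s t≤n) = cong suc (sum-lo t t≤n)

sum-hi : ∀ {n} t → t ≤ n → t + sum {n} (hi t) ≡ n
sum-hi {n} t t≤n = begin
  t + sum (hi {n} t)                 ≡⟨ cong (_+ sum (hi {n} t)) (sum-lo t t≤n) ⟨
  sum {n} (lo t) + sum (hi {n} t)    ≡⟨ ∑-distrib-+ (lo {n} t) (hi t) ⟨
  sum (λ i → lo {n} t i + hi t i) ≡⟨ sum-cong-≗ (lo+hi {n} t) ⟩
  sum {n} (λ _ → 1)              ≡⟨ sum-const n 1 ⟩
  n * 1                          ≡⟨ *-identityʳ n ⟩
  n                              ∎
  where open ≡-Reasoning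

sum-lo+hi : ∀ {n} t (f : Fin n → ℕ) → sum (λ i → lo t i * f i) + sum (λ i → hi t i * f i) ≡ sum f
sum-lo+hi t f = trans (sym (∑-distrib-+ (λ i → lo t i * f i) (λ i → hi t i * f i))) (sum-cong-≗ λ i → begin
  lo t i * f i + hi t i * f i   ≡⟨ *-distribʳ-+ (f i) (lo t i) (hi t i) ⟨
  (lo t i + hi t i) * f i       ≡⟨ cong (_* f i) (lo+hi t i) ⟩
  1 * f i                       ≡⟨ *-identityˡ (f i) ⟩
  f i                           ∎)
  where open ≡-Reasoning

-- The Erdős–Gallai inequality at t, with t (t − 1) written as t² on the right
-- and t on the left.
ErdősGallai : ∀ {n} → (Fin n → ℕ) → ℕ → Set
ErdősGallai e t = sum (λ i → lo t i * e i) + t ≤ t * t + sum (λ i → hi t i * (t ⊓ e i))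

module _ {n} (G : Graph n) (t : ℕ) where

  inside : Fin n → ℕ
  inside v = sum (λ q → lo t q * 𝟙 (adj G v q))

  -- Double counting: the edge ends at the first `t` vertices are counted from the opposite end. The
  -- two sums are the contributions from within this block and from across its border.
  sum-lo-deg : sum (λ i → lo t i * deg G i) ≡ sum (λ i → lo t i * inside i) + sum (λ i → hi t i * inside i)
  sum-lo-deg = begin
    sum (λ i → lo t i * deg G i)                          ≡⟨ sum-cong-≗ (λ i → *-distribˡ-sum (lo t i) (𝟙 ∘ adj G i)) ⟩
    sum (λ i → sum (λ q → lo t i * 𝟙 (adj G i q)))        ≡⟨ ∑-comm (λ i q → lo t i * 𝟙 (adj G i q)) ⟩
    sum (λ q → sum (λ i → lo t i * 𝟙 (adj G i q)))        ≡⟨ sum-cong-≗ (λ q → sum-cong-≗ (λ i → cong (λ b → lo t i * 𝟙 b) (Graph.sym G i q))) ⟩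
    sum inside                                            ≡⟨ sum-lo+hi t inside ⟨
    sum (λ i → lo t i * inside i) + sum (λ i → hi t i * inside i) ∎
    where open ≡-Reasoning

  inside≤deg : ∀ v → inside v ≤ deg G v
  inside≤deg v = sum-mono-≤ pointwise
    where
    pointwise : ∀ q → lo t q * 𝟙 (adj G v q) ≤ 𝟙 (adj G v q)
    pointwise q with toℕ q <ᵇ t
    ... | true  = ≤-reflexive (+-identityʳ _)
    ... | false = z≤n

  inside≤t : t ≤ n → ∀ v → inside v ≤ t
  inside≤t t≤n v = ≤-trans (sum-mono-≤ pointwise) (≤-reflexive (sum-lo t t≤n))
    where
    pointwise : ∀ q → lo t q * 𝟙 (adj G v q) ≤ lo t q
    pointwise q with adj G v q
    ... | true  = ≤-reflexive (*-identityʳ _)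
    ... | false = ≤-trans (≤-reflexive (*-zeroʳ (lo t q))) z≤n

  -- The vertex `v` belongs to the block without being its own neighbour; `δ v` occupies the free
  -- unit.
  inside<t : t ≤ n → ∀ v → toℕ v < t → inside v < t
  inside<t t≤n v v<t = begin
    1 + inside v                                     ≡⟨ +-comm 1 (inside v) ⟩
    inside v + 1                                     ≡⟨ cong (inside v +_) (sum-δ v) ⟨
    inside v + sum (δ v)                             ≡⟨ ∑-distrib-+ (λ q → lo t q * 𝟙 (adj G v q)) (δ v) ⟨
    sum (λ q → lo t q * 𝟙 (adj G v q) + δ v q)       ≤⟨ sum-mono-≤ pointwise ⟩
    sum (lo {n} t)                                   ≡⟨ sum-lo t t≤n ⟩
    t                                                ∎
    where
    open ≤-Reasoning
    pointwise : ∀ q → lo t q * 𝟙 (adj G v q) + δ v q ≤ lo t q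
    pointwise q with v Fin.≟ q
    ... | yes refl rewrite irrefl G v | *-zeroʳ (lo t v) with position t v
    ...   | below _ lo≡1 _ = ≤-reflexive (sym lo≡1)
    ...   | above t≤v _ _  = contradiction v<t (≤⇒≯ t≤v)
    pointwise q | no _ rewrite +-identityʳ (lo t q * 𝟙 (adj G v q)) with adj G v q
    ... | true  = ≤-reflexive (*-identityʳ _)
    ... | false = ≤-trans (≤-reflexive (*-zeroʳ (lo t q))) z≤n

  -- A vertex of the block has at most t - 1 neighbours there, and a vertex outside sends at most
  -- min(t, degree) edges into it.
  erdős-gallai-necessary : t ≤ n → ErdősGallai (deg G) t
  erdős-gallai-necessary t≤n = begin
    sum (λ i → lo t i * deg G i) + t                   ≡⟨ cong (_+ t) sum-lo-deg ⟩
    low + high + t                                     ≡⟨ shuffle low high t ⟩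
    (low + t) + high                                   ≤⟨ +-mono-≤ low-bound (sum-mono-≤ (λ i → *-monoʳ-≤ (hi t i) (⊓-glb (inside≤t t≤n i) (inside≤deg i)))) ⟩
    t * t + sum (λ i → hi t i * (t ⊓ deg G i))         ∎
    where
    open ≤-Reasoning
    low = sum (λ i → lo t i * inside i)
    high = sum (λ i → hi t i * inside i)
    shuffle : ∀ a b c → a + b + c ≡ (a + c) + b
    shuffle = solve-∀
    pointwise : ∀ i → lo t i * inside i + lo t i ≤ lo t i * t
    pointwise i with position t i
    ... | below i<t lo≡1 _ rewrite lo≡1 | +-identityʳ (inside i) | +-identityʳ t | +-comm (inside i) 1 = inside<t t≤n i i<t
    ... | above _ lo≡0 _ rewrite lo≡0 = z≤n
    low-bound : low + t ≤ t * t
    low-bound = begin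
      low + t                                     ≡⟨ cong (low +_) (sum-lo t t≤n) ⟨
      low + sum (lo {n} t)                        ≡⟨ ∑-distrib-+ (λ i → lo t i * inside i) (lo t) ⟨
      sum (λ i → lo t i * inside i + lo t i)      ≤⟨ sum-mono-≤ pointwise ⟩
      sum (λ i → lo {n} t i * t)                  ≡⟨ *-distribʳ-sum t (lo {n} t) ⟨
      sum (lo {n} t) * t                          ≡⟨ cong (_* t) (sum-lo t t≤n) ⟩
      t * t                                       ∎

  -- A clique on the first t vertices, an independent set on the others, and no
  -- room for further edges between them: the inequality at t is then tight.
  erdős-gallai-tight : (e : Fin n → ℕ) → t ≤ n → ErdősGallai e t →
    (∀ i j → toℕ i < t → toℕ j < t → i ≢ j → adj G i j ≡ true) →
    (∀ i j → t ≤ toℕ i → t ≤ toℕ j → adj G i j ≡ false) →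
    (∀ i → t ≤ toℕ i → t ⊓ e i ≤ deg G i) →
    sum (λ i → lo t i * e i) ≤ sum (λ i → lo t i * deg G i)
  erdős-gallai-tight e t≤n eg clique indep sat = +-cancelʳ-≤ t _ _ (begin
    sum (λ i → lo t i * e i) + t                       ≤⟨ eg ⟩
    t * t + sum (λ i → hi t i * (t ⊓ e i))             ≤⟨ +-mono-≤ low-bound (sum-mono-≤ high-bound) ⟩
    (low + t) + high                                   ≡⟨ shuffle low high t ⟨
    low + high + t                                     ≡⟨ cong (_+ t) sum-lo-deg ⟨
    sum (λ i → lo t i * deg G i) + t                   ∎)
    where
    open ≤-Reasoning
    low = sum (λ i → lo t i * inside i)
    high = sum (λ i → hi t i * inside i)
    shuffle : ∀ a b c → a + b + c ≡ (a + c) + b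
    shuffle = solve-∀
    high-bound : ∀ i → hi t i * (t ⊓ e i) ≤ hi t i * inside i
    high-bound i with position t i
    ... | below _ _ hi≡0 rewrite hi≡0 = z≤n
    ... | above t≤i _ hi≡1 rewrite hi≡1 = +-monoˡ-≤ 0 (≤-trans (sat i t≤i) (≤-reflexive (sum-cong-≗ neighbours-low)))
      where
      -- By independence all neighbours of `i` lie in the block, so `inside i` is its whole degree.
      neighbours-low : ∀ q → 𝟙 (adj G i q) ≡ lo t q * 𝟙 (adj G i q)
      neighbours-low q with position t q
      ... | below _ lo≡1 _ rewrite lo≡1 = sym (+-identityʳ _)
      ... | above t≤q _ _ rewrite indep i q t≤i t≤q = sym (*-zeroʳ (lo t q))
    t≤inside : ∀ i → toℕ i < t → t ≤ inside i + 1
    t≤inside i i<t = begin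
      t                                             ≡⟨ sum-lo t t≤n ⟨
      sum (lo {n} t)                                ≤⟨ sum-mono-≤ pointwise ⟩
      sum (λ q → lo t q * 𝟙 (adj G i q) + δ i q)    ≡⟨ ∑-distrib-+ (λ q → lo t q * 𝟙 (adj G i q)) (δ i) ⟩
      inside i + sum (δ i)                          ≡⟨ cong (inside i +_) (sum-δ i) ⟩
      inside i + 1                                  ∎
      where
      pointwise : ∀ q → lo t q ≤ lo t q * 𝟙 (adj G i q) + δ i q
      pointwise q with position t q
      ... | above _ lo≡0 _ rewrite lo≡0 = z≤n
      ... | below q<t lo≡1 _ rewrite lo≡1 with i Fin.≟ q
      ...   | yes _  = m≤n+m 1 _
      ...   | no i≢q rewrite clique i q i<t q<t i≢q = ≤-refl
    low-bound : t * t ≤ low + t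
    low-bound = begin
      t * t                                       ≡⟨ cong (_* t) (sum-lo t t≤n) ⟨
      sum (lo {n} t) * t                          ≡⟨ *-distribʳ-sum t (lo {n} t) ⟩
      sum (λ i → lo {n} t i * t)                  ≤⟨ sum-mono-≤ pointwise ⟩
      sum (λ i → lo t i * inside i + lo t i)      ≡⟨ ∑-distrib-+ (λ i → lo t i * inside i) (lo t) ⟩
      low + sum (lo {n} t)                        ≡⟨ cong (low +_) (sum-lo t t≤n) ⟩
      low + t                                     ∎
      where
      pointwise : ∀ i → lo t i * t ≤ lo t i * inside i + lo t i
      pointwise i with position t i
      ... | below i<t lo≡1 _ rewrite lo≡1 | +-identityʳ (inside i) | +-identityʳ t = t≤inside i i<t
      ... | above _ lo≡0 _ rewrite lo≡0 = z≤n

-- Sufficiency of the Erdős-Gallai inequalities: filling the degrees vertex by vertex.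

<⇒≢ᶠ : ∀ {n} {i j : Fin n} → toℕ i < toℕ j → i ≢ j
<⇒≢ᶠ i<j refl = <-irrefl refl i<j

emptyGraph : ∀ n → Graph n
emptyGraph n = record { adj = λ _ _ → false ; sym = λ _ _ → refl ; irrefl = λ _ → refl }

deg-emptyGraph : ∀ {n} v → deg (emptyGraph n) v ≡ 0
deg-emptyGraph {n} v = trans (sum-const n 0) (*-zeroʳ n)

-- A state of the Tripathi–Venugopalan–West construction with 0-based critical
-- index r.
record Partial {n} (e : Fin n → ℕ) (r : ℕ) (G : Graph n) : Set where
  field
    deg≤  : ∀ v → deg G v ≤ e v
    full  : ∀ v → toℕ v < r → deg G v ≡ e v
    indep : ∀ {p q} → r < toℕ p → r < toℕ q → adj G p q ≢ true

module _ {n} (e : Fin n → ℕ) (e-mono : ∀ {i j} → toℕ i ≤ toℕ j → e j ≤ e i)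
         (e-even : 2 ∣ sum e) (e-eg : ∀ t → t ≤ n → ErdősGallai e t) where

  module Progress (r : Fin n) (G : Graph n) (P : Partial e (toℕ r) G) (deficient : deg G r < e r) where
    open Partial P

    Step : Set
    Step = ∃ λ G′ → Partial e (toℕ r) G′ × deg G r < deg G′ r

    -- A new edge must have an end at or before `r`; the independence of the later vertices is then
    -- inherited from `G`.
    NoNew : Graph n → Set
    NoNew H = ∀ {p q} → toℕ r < toℕ p → toℕ r < toℕ q → adj H p q ≡ true → adj G p q ≡ true

    noNew-rotation : ∀ {u i} (R : Rotation G u i r) → NoNew (Rotation.graph R)
    noNew-rotation R r<p r<q pq with Rotation.gain R pq
    ... | inj₁ pq′             = pq′
    ... | inj₂ (inj₁ (_ , refl)) = contradiction r<q (<-irrefl refl)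
    ... | inj₂ (inj₂ (_ , refl)) = contradiction r<p (<-irrefl refl)

    noNew-add : ∀ H {x y} → NoNew H → (x≢y : x ≢ y) → toℕ x ≤ toℕ r → NoNew (addEdge H x≢y)
    noNew-add H {x} {y} H-old x≢y x≤r {p} {q} r<p r<q pq =
      H-old r<p r<q (trans (sym (setEdge-other true H x≢y
        λ { (inj₁ (refl , _)) → <⇒≱ r<p x≤r ; (inj₂ (refl , _)) → <⇒≱ r<q x≤r })) pq)

    noNew-del : ∀ H {x y} → NoNew H → (x≢y : x ≢ y) → NoNew (delEdge H x≢y)
    noNew-del H {x} {y} H-old x≢y {p} {q} r<p r<q pq =
      H-old r<p r<q (trans (sym (setEdge-other false H x≢y
        λ s → true≢false pq (setEdge-same false H x≢y s))) pq)

    deficient⇒≥ : ∀ {v} → deg G v < e v → toℕ r ≤ toℕ v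
    deficient⇒≥ {v} v-def = ≮⇒≥ λ v<r → <-irrefl (full v v<r) v-def

    -- Earlier vertices are full and `e` is non-increasing. This strict gap is what allows
    -- `exchange-vertex` to move an edge end from `i` to `r`.
    deg-below : ∀ {i} → toℕ i < toℕ r → deg G r < deg G i
    deg-below {i} i<r = <-≤-trans deficient (≤-trans (e-mono (<⇒≤ i<r)) (≤-reflexive (sym (full i i<r))))

    -- First shape of a step: `r` and `k` gain one unit each. The case that `k` is `r` is allowed,
    -- and then `r` gains two.
    raise : ∀ H k → NoNew H → (∀ v → deg H v ≡ deg G v + (δ r v + δ k v)) →
      (∀ v → deg G v + (δ r v + δ k v) ≤ e v) → Step
    raise H k H-old degs room = H , record
      { deg≤  = bounded
      ; full  = λ v v<r → ≤-antisym (bounded v) (≤-trans (≤-reflexive (sym (full v v<r)))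
                  (≤-trans (m≤m+n _ _) (≤-reflexive (sym (degs v)))))
      ; indep = λ r<p r<q pq → indep r<p r<q (H-old r<p r<q pq)
      } , (begin-strict
        deg G r                     <⟨ m<m+n (deg G r) z<s ⟩
        deg G r + (1 + δ k r)       ≡⟨ cong (λ x → deg G r + (x + δ k r)) (δ-refl r) ⟨
        deg G r + (δ r r + δ k r)   ≡⟨ degs r ⟨
        deg H r                     ∎)
      where
      open ≤-Reasoning
      bounded : ∀ v → deg H v ≤ e v
      bounded v = ≤-trans (≤-reflexive (degs v)) (room v)

    -- Second shape of a step: `r` takes a unit from a later vertex, which is permitted because
    -- later vertices need not be full.
    shift : ∀ H w → toℕ r < toℕ w → NoNew H → (∀ v → deg H v + δ w v ≡ deg G v + δ r v) → Step
    shift H w r<w H-old degs = H , record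
      { deg≤  = bounded
      ; full  = λ v v<r → trans (trans (sym (+-identityʳ _)) (trans (cong (deg H v +_) (sym (δ-≢ (<⇒≢ᶠ (<-trans v<r r<w) ∘ sym))))
                  (trans (degs v) (trans (cong (deg G v +_) (δ-≢ (<⇒≢ᶠ v<r ∘ sym))) (+-identityʳ _))))) (full v v<r)
      ; indep = λ r<p r<q pq → indep r<p r<q (H-old r<p r<q pq)
      } , (begin-strict
        deg G r             <⟨ n<1+n _ ⟩
        1 + deg G r         ≡⟨ +-comm 1 _ ⟩
        deg G r + 1         ≡⟨ cong (deg G r +_) (δ-refl r) ⟨
        deg G r + δ r r     ≡⟨ degs r ⟨
        deg H r + δ w r     ≡⟨ cong (deg H r +_) (δ-≢ (<⇒≢ᶠ r<w ∘ sym)) ⟩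
        deg H r + 0         ≡⟨ +-identityʳ _ ⟩
        deg H r             ∎)
      where
      open ≤-Reasoning
      room : ∀ v → deg G v + δ r v ≤ e v
      room v with r Fin.≟ v
      ... | yes refl = ≤-trans (≤-reflexive (+-comm _ 1)) deficient
      ... | no _     = ≤-trans (≤-reflexive (+-identityʳ _)) (deg≤ v)
      bounded : ∀ v → deg H v ≤ e v
      bounded v = ≤-trans (m≤m+n _ _) (≤-trans (≤-reflexive (degs v)) (room v))

    room-two : ∀ {k} → k ≢ r → deg G k < e k → ∀ v → deg G v + (δ r v + δ k v) ≤ e v
    room-two {k} k≢r k-def v with r Fin.≟ v | k Fin.≟ v
    ... | yes refl | yes refl = contradiction refl k≢r
    ... | yes refl | no _     = ≤-trans (≤-reflexive (+-comm _ 1)) deficient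
    ... | no _     | yes refl = ≤-trans (≤-reflexive (+-comm _ 1)) k-def
    ... | no _     | no _     = ≤-trans (≤-reflexive (+-identityʳ _)) (deg≤ v)

    -- By parity, r cannot be the only deficient vertex with deficiency one.
    room-double : (∀ k → k ≢ r → ¬ deg G k < e k) → ∀ v → deg G v + (δ r v + δ r v) ≤ e v
    room-double others v with r Fin.≟ v
    ... | no _     = ≤-trans (≤-reflexive (+-identityʳ _)) (deg≤ v)
    ... | yes refl with suc (deg G r) ≟ e r
    ...   | no 1+deg≢e = ≤-trans (≤-reflexive (+-comm _ 2)) (≤∧≢⇒< deficient 1+deg≢e)
    ...   | yes 1+deg≡e = contradiction (∣1⇒≡1 (∣m+n∣m⇒∣n (subst (2 ∣_) total e-even) (handshake G))) λ ()
      where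
      pointwise : ∀ v → e v ≡ deg G v + δ r v
      pointwise v with r Fin.≟ v
      ... | yes refl = trans (sym 1+deg≡e) (+-comm 1 _)
      ... | no r≢v   = trans (sym (≤∧≮⇒≡ (deg≤ v) (others v (r≢v ∘ sym)))) (sym (+-identityʳ _))
      total : sum e ≡ sum (deg G) + 1
      total = trans (sum-cong-≗ pointwise) (trans (∑-distrib-+ (deg G) (δ r)) (cong (sum (deg G) +_) (sum-δ r)))

    join-deficient : ∀ {k} → k ≢ r → adj G r k ≡ false → deg G k < e k → Step
    join-deficient {k} k≢r rk k-def = raise (addEdge G (k≢r ∘ sym)) k (noNew-add G (λ _ _ pq → pq) (k≢r ∘ sym) ≤-refl)
      (deg-addEdge G (k≢r ∘ sym) rk) (room-two k≢r k-def)

    deg-rotate-add : ∀ H F i j → (∀ v → deg H v + δ i v ≡ deg G v + δ r v) →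
      (∀ v → deg F v ≡ deg H v + (δ i v + δ j v)) → ∀ v → deg F v ≡ deg G v + (δ r v + δ j v)
    deg-rotate-add H F i j rot add v = begin
      deg F v                       ≡⟨ add v ⟩
      deg H v + (δ i v + δ j v)     ≡⟨ +-assoc (deg H v) (δ i v) (δ j v) ⟨
      deg H v + δ i v + δ j v       ≡⟨ cong (_+ δ j v) (rot v) ⟩
      deg G v + δ r v + δ j v       ≡⟨ +-assoc (deg G v) (δ r v) (δ j v) ⟩
      deg G v + (δ r v + δ j v)     ∎
      where open ≡-Reasoning

    deg-rotate-del-add : ∀ H K F i j w → (∀ v → deg H v + δ i v ≡ deg G v + δ r v) →
      (∀ v → deg K v + (δ j v + δ w v) ≡ deg H v) → (∀ v → deg F v ≡ deg K v + (δ i v + δ j v)) →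
      ∀ v → deg F v + δ w v ≡ deg G v + δ r v
    deg-rotate-del-add H K F i j w rot del add v = begin
      deg F v + δ w v                       ≡⟨ cong (_+ δ w v) (add v) ⟩
      deg K v + (δ i v + δ j v) + δ w v     ≡⟨ shuffle (deg K v) (δ i v) (δ j v) (δ w v) ⟩
      deg K v + (δ j v + δ w v) + δ i v     ≡⟨ cong (_+ δ i v) (del v) ⟩
      deg H v + δ i v                       ≡⟨ rot v ⟩
      deg G v + δ r v                       ∎
      where
      open ≡-Reasoning
      shuffle : ∀ k i j w → k + (i + j) + w ≡ k + (j + w) + i
      shuffle = solve-∀

    -- Turning iu into ru and adding ir restores `i` and gives `r` two units. If no other vertex is
    -- deficient, parity leaves room for both. If some `k` is, then rk is added when absent; when
    -- present, it is deleted along with the previous changes, so that `r` gains one and `k` loses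
    -- one.
    missing-neighbour : ∀ {i} → toℕ i < toℕ r → adj G i r ≡ false → Step
    missing-neighbour {i} i<r ir with exchange-vertex G (<⇒≢ᶠ i<r) (deg-below i<r)
    ... | u , iu , ru , u≢r = by-second-deficiency (Fin.any? λ k → ¬? (k Fin.≟ r) ×-dec deg G k <? e k)
      where
      i≢r = <⇒≢ᶠ i<r
      i≢u = adj⇒≢ G iu
      R = rotate G iu ru u≢r i≢r
      open Rotation R using (deg-rot; off-centre) renaming (graph to H)
      H-ir : adj H i r ≡ false
      H-ir = trans (off-centre i≢u (u≢r ∘ sym)) ir
      by-second-deficiency : Dec (∃ λ k → k ≢ r × deg G k < e k) → Step
      by-second-deficiency (no none) =
        raise (addEdge H i≢r) r (noNew-add H (noNew-rotation R) i≢r (<⇒≤ i<r))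
          (deg-rotate-add H (addEdge H i≢r) i r deg-rot (deg-addEdge H i≢r H-ir))
          (room-double (λ k k≢r k-def → none (k , k≢r , k-def)))
      by-second-deficiency (yes (k , k≢r , k-def)) with adj G r k in rk
      ... | false = join-deficient k≢r rk k-def
      ... | true  =
        shift (addEdge K i≢r) k (≤∧≢⇒< (deficient⇒≥ k-def) (k≢r ∘ sym ∘ Fin.toℕ-injective))
          (noNew-add K (noNew-del H (noNew-rotation R) r≢k) i≢r (<⇒≤ i<r))
          (deg-rotate-del-add H K (addEdge K i≢r) i r k deg-rot (deg-delEdge H r≢k H-rk) (deg-addEdge K i≢r K-ir))
        where
        r≢k = k≢r ∘ sym
        k≢u : k ≢ u
        k≢u refl = true≢false rk ru
        H-rk : adj H r k ≡ true
        H-rk = trans (off-centre (u≢r ∘ sym) k≢u) rk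
        K = delEdge H r≢k
        K-ir : adj K i r ≡ false
        K-ir = trans (setEdge-other false H r≢k λ { (inj₁ (r≡i , _)) → i≢r (sym r≡i)
                                                  ; (inj₂ (_ , refl)) → true≢false (adj-sym G rk) ir }) H-ir

    module _ (joined : ∀ i → toℕ i < toℕ r → adj G i r ≡ true) where

      non-neighbour-above : ∀ {u} → u ≢ r → adj G r u ≡ false → toℕ r < toℕ u
      non-neighbour-above {u} u≢r ru = ≤∧≢⇒<
        (≮⇒≥ λ u<r → true≢false (adj-sym G (joined u u<r)) ru) (u≢r ∘ sym ∘ Fin.toℕ-injective)

      -- If rk is present, `k` still misses some `i` before `r`, since its degree is below the
      -- number r + 1 of vertices up to `r`. Turning iu into ru and adding ik then serves both `r`
      -- and `k`.
      unsaturated : ∀ {k} → toℕ r < toℕ k → deg G k < suc (toℕ r) ⊓ e k → Step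
      unsaturated {k} r<k k-low with adj G r k in rk
      ... | false = join-deficient (<⇒≢ᶠ r<k ∘ sym) rk (<-≤-trans k-low (m⊓n≤n _ _))
      ... | true with Fin.any? (λ i → (toℕ i ≤? toℕ r) ×-dec (adj G k i ≟ᵇ false))
      ...   | no none = contradiction k-low (≤⇒≯ (≤-trans (m⊓n≤m _ _) (begin
                suc (toℕ r)            ≡⟨ sum-lo (suc (toℕ r)) (Fin.toℕ<n r) ⟨
                sum (lo {n} (suc (toℕ r))) ≤⟨ sum-mono-≤ pointwise ⟩
                deg G k                ∎)))
        where
        open ≤-Reasoning
        pointwise : ∀ i → lo (suc (toℕ r)) i ≤ 𝟙 (adj G k i)
        pointwise i with position (suc (toℕ r)) i
        ... | above _ lo≡0 _ rewrite lo≡0 = z≤n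
        ... | below (s≤s i≤r) lo≡1 _ rewrite lo≡1 with adj G k i in ki
        ...   | true  = ≤-refl
        ...   | false = contradiction (i , i≤r , ki) none
      ...   | yes (i , i≤r , ki) = via-exchange (exchange-vertex G i≢r (deg-below i<r))
        where
        i≢r : i ≢ r
        i≢r refl = true≢false (adj-sym G rk) ki
        i<r = ≤∧≢⇒< i≤r (i≢r ∘ Fin.toℕ-injective)
        i≢k = <⇒≢ᶠ (<-trans i<r r<k)
        via-exchange : (∃ λ u → adj G i u ≡ true × adj G r u ≡ false × u ≢ r) → Step
        via-exchange (u , iu , ru , u≢r) =
          raise (addEdge H i≢k) k (noNew-add H (noNew-rotation R) i≢k i≤r)
            (deg-rotate-add H (addEdge H i≢k) i k deg-rot (deg-addEdge H i≢k H-ik))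
            (room-two (<⇒≢ᶠ r<k ∘ sym) (<-≤-trans k-low (m⊓n≤n _ _)))
          where
          R = rotate G iu ru u≢r i≢r
          open Rotation R using (deg-rot; off-centre) renaming (graph to H)
          k≢u : k ≢ u
          k≢u refl = true≢false rk ru
          H-ik : adj H i k ≡ false
          H-ik = trans (off-centre (adj⇒≢ G iu) k≢u) (adj-sym G ki)

      -- Turn iu into ru, delete jw and add ij: `i` and `j` are restored and `r` gains a unit at the
      -- cost of `w`, which lies after `r` because all earlier vertices are joined to `r`.
      missing-edge : ∀ {i j} → toℕ i < toℕ r → toℕ j < toℕ r → i ≢ j → adj G i j ≡ false → Step
      missing-edge {i} {j} i<r j<r i≢j ij =
        via-exchange (exchange-vertex G (<⇒≢ᶠ i<r) (deg-below i<r)) (exchange-vertex G (<⇒≢ᶠ j<r) (deg-below j<r))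
        where
        i≢r = <⇒≢ᶠ i<r
        j≢r = <⇒≢ᶠ j<r
        via-exchange : (∃ λ u → adj G i u ≡ true × adj G r u ≡ false × u ≢ r) →
                       (∃ λ w → adj G j w ≡ true × adj G r w ≡ false × w ≢ r) → Step
        via-exchange (u , iu , ru , u≢r) (w , jw , rw , w≢r) =
          shift (addEdge K i≢j) w r<w (noNew-add K (noNew-del H (noNew-rotation R) j≢w) i≢j (<⇒≤ i<r))
            (deg-rotate-del-add H K (addEdge K i≢j) i j w deg-rot (deg-delEdge H j≢w H-jw) (deg-addEdge K i≢j K-ij))
          where
          r<u = non-neighbour-above u≢r ru
          r<w = non-neighbour-above w≢r rw
          j≢w = adj⇒≢ G jw
          j≢u = <⇒≢ᶠ (<-trans j<r r<u)
          R = rotate G iu ru u≢r i≢r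
          open Rotation R using (deg-rot; off-centre; other) renaming (graph to H)
          H-jw : adj H j w ≡ true
          H-jw = trans (other (λ { (inj₁ (u≡j , _)) → j≢u (sym u≡j) ; (inj₂ (_ , i≡j)) → i≢j i≡j })
                              (λ { (inj₁ (u≡j , _)) → j≢u (sym u≡j) ; (inj₂ (_ , r≡j)) → j≢r (sym r≡j) })) jw
          K = delEdge H j≢w
          K-ij : adj K i j ≡ false
          K-ij = trans (setEdge-other false H j≢w λ { (inj₁ (j≡i , _)) → i≢j (sym j≡i)
                                                    ; (inj₂ (_ , w≡i)) → <⇒≢ᶠ (<-trans i<r r<w) (sym w≡i) })
                       (trans (off-centre (adj⇒≢ G iu) j≢u) ij)

      -- When no move applies, the vertices up to `r` form a clique and the later ones are
      -- independent and saturated. The inequality at r + 1 then leaves no deficiency in the block,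
      -- against that of `r`.
      step-joined : Step
      step-joined with Fin.any? (λ k → (toℕ r <? toℕ k) ×-dec (deg G k <? suc (toℕ r) ⊓ e k))
      ... | yes (k , r<k , k-low) = unsaturated r<k k-low
      ... | no saturated with Fin.any? (λ i → Fin.any? λ j →
                           (toℕ i <? toℕ r) ×-dec (toℕ j <? toℕ r) ×-dec ¬? (i Fin.≟ j) ×-dec (adj G i j ≟ᵇ false))
      ...   | yes (i , j , i<r , j<r , i≢j , ij) = missing-edge i<r j<r i≢j ij
      ...   | no complete = contradiction tight (<⇒≱ strict)
        where
        t = suc (toℕ r)
        clique : ∀ i j → toℕ i < t → toℕ j < t → i ≢ j → adj G i j ≡ true
        clique i j (s≤s i≤r) (s≤s j≤r) i≢j with i Fin.≟ r | j Fin.≟ r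
        ... | yes refl | yes refl = contradiction refl i≢j
        ... | yes refl | no j≢r   = adj-sym G (joined j (≤∧≢⇒< j≤r (j≢r ∘ Fin.toℕ-injective)))
        ... | no i≢r   | yes refl = joined i (≤∧≢⇒< i≤r (i≢r ∘ Fin.toℕ-injective))
        ... | no i≢r   | no j≢r   = ¬false⇒true λ ij → complete
              (i , j , ≤∧≢⇒< i≤r (i≢r ∘ Fin.toℕ-injective) , ≤∧≢⇒< j≤r (j≢r ∘ Fin.toℕ-injective) , i≢j , ij)
        tight : sum (λ i → lo t i * e i) ≤ sum (λ i → lo t i * deg G i)
        tight = erdős-gallai-tight G t e (Fin.toℕ<n r) (e-eg t (Fin.toℕ<n r)) clique
          (λ i j r<i r<j → ¬true⇒false (indep r<i r<j)) (λ k r<k → ≮⇒≥ λ k-low → saturated (k , r<k , k-low))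
        lo≡1 : lo t r ≡ 1
        lo≡1 with position t r
        ... | below _ eq _  = eq
        ... | above t≤r _ _ = contradiction t≤r (<⇒≱ (n<1+n _))
        strict : sum (λ i → lo t i * deg G i) < sum (λ i → lo t i * e i)
        strict = sum-mono-< (λ i → *-monoʳ-≤ (lo t i) (deg≤ i)) r
          (subst (λ x → x * deg G r < x * e r) (sym lo≡1) (*-monoʳ-< 1 deficient))

    step : Step
    step with Fin.any? (λ i → (toℕ i <? toℕ r) ×-dec (adj G i r ≟ᵇ false))
    ... | yes (i , i<r , ir) = missing-neighbour i<r ir
    ... | no none = step-joined λ i i<r → ¬false⇒true λ ir → none (i , i<r , ir)

  -- `b` bounds the missing degree of `r` and drops with each step, which makes the recursion
  -- terminate.
  complete : (r : Fin n) (b : ℕ) (G : Graph n) → Partial e (toℕ r) G → e r ≤ b + deg G r → ∃ (Partial e (suc (toℕ r)))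
  complete r b G P e≤b+deg with deg G r <? e r
  ... | no done = G , record
    { deg≤  = deg≤
    ; full  = full′
    ; indep = λ r<p r<q → indep (<-trans (n<1+n _) r<p) (<-trans (n<1+n _) r<q)
    }
    where
    open Partial P
    full′ : ∀ v → toℕ v < suc (toℕ r) → deg G v ≡ e v
    full′ v (s≤s v≤r) with v Fin.≟ r
    ... | yes refl = ≤-antisym (deg≤ r) (≮⇒≥ done)
    ... | no v≢r   = full v (≤∧≢⇒< v≤r (v≢r ∘ Fin.toℕ-injective))
  complete r zero    G P e≤deg | yes def = contradiction def (≤⇒≯ e≤deg)
  complete r (suc b) G P e≤b+deg | yes def =
    let G′ , P′ , more = Progress.step r G P def
    in complete r b G′ P′ (≤-trans e≤b+deg (≤-trans (≤-reflexive (sym (+-suc b _))) (+-monoʳ-≤ b more)))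

  partial : ∀ r → r ≤ n → ∃ (Partial e r)
  partial zero _ = emptyGraph n , record
    { deg≤  = λ v → ≤-trans (≤-reflexive (deg-emptyGraph v)) z≤n
    ; full  = λ _ ()
    ; indep = λ _ _ () }
  partial (suc r) r<n =
    let G , P   = partial r (<⇒≤ r<n)
        ρ       = fromℕ< r<n
        toℕρ≡r  = Fin.toℕ-fromℕ< r<n
        G′ , P′ = complete ρ (e ρ) G (subst (λ x → Partial e x G) (sym toℕρ≡r) P) (m≤m+n _ _)
    in G′ , subst (λ x → Partial e (suc x) G′) toℕρ≡r P′

  erdős-gallai-sufficient : ∃ λ G → ∀ v → deg G v ≡ e v
  erdős-gallai-sufficient =
    let G , P = partial n ≤-refl
    in G , λ v → Partial.full P v (Fin.toℕ<n v)

-- Switches, and the removal of B ∖ A in Kundu's theorem.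

-- Trades the edges ab, cd for ac, bd.
record Switch {n} (G : Graph n) (a b c d : Fin n) : Set where
  field
    graph   : Graph n
    deg≡    : ∀ p → deg graph p ≡ deg G p
    added   : adj graph a c ≡ true
    removed : adj graph a b ≡ false
    gain    : ∀ {p q} → adj graph p q ≡ true → adj G p q ≡ true ⊎ Same a c p q ⊎ Same d b p q
    loss    : ∀ {p q} → adj G p q ≡ true → adj graph p q ≡ true ⊎ Same a b p q ⊎ Same d c p q

-- A switch is two rotations, ab to ac about `a` and dc to db about `d`; the unit that the first
-- passes from `b` to `c` is returned by the second.
compose : ∀ {n} {G : Graph n} {a b c d : Fin n} → adj G a b ≡ true → a ≢ c → a ≢ d →
  (R₁ : Rotation G a b c) → Rotation (Rotation.graph R₁) d c b → Switch G a b c d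
compose {G = G} {a} {b} {c} {d} ab a≢c a≢d R₁ R₂ = record
  { graph   = R₂.graph
  ; deg≡    = λ p → +-cancelʳ-≡ (δ b p + δ c p) _ _
                (degrees (deg R₂.graph p) (deg R₁.graph p) (deg G p) (δ b p) (δ c p) (R₁.deg-rot p) (R₂.deg-rot p))
  ; added   = added
  ; removed = ¬true⇒false removed
  ; gain    = gain
  ; loss    = loss
  }
  where
  module R₁ = Rotation R₁
  module R₂ = Rotation R₂
  b≢a : b ≢ a
  b≢a = adj⇒≢ G (adj-sym G ab)
  degrees : ∀ h₂ h₁ g x y → h₁ + x ≡ g + y → h₂ + y ≡ h₁ + x → h₂ + (x + y) ≡ g + (x + y)
  degrees h₂ h₁ g x y e₁ e₂ = begin
    h₂ + (x + y)  ≡⟨ swap h₂ x y ⟩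
    (h₂ + y) + x  ≡⟨ cong (_+ x) (trans e₂ e₁) ⟩
    (g + y) + x   ≡⟨ swap g x y ⟨
    g + (x + y)   ∎
    where
    open ≡-Reasoning
    swap : ∀ h x y → h + (x + y) ≡ (h + y) + x
    swap = solve-∀
  added : adj R₂.graph a c ≡ true
  added with R₂.loss R₁.added
  ... | inj₁ ac′ = ac′
  ... | inj₂ (inj₁ (d≡a , _)) = contradiction (sym d≡a) a≢d
  ... | inj₂ (inj₂ (_ , c≡a)) = contradiction (sym c≡a) a≢c
  removed : adj R₂.graph a b ≢ true
  removed ab′ with R₂.gain ab′
  ... | inj₁ ab₁ = true≢false ab₁ R₁.removed
  ... | inj₂ (inj₁ (d≡a , _)) = a≢d (sym d≡a)
  ... | inj₂ (inj₂ (_ , b≡a)) = b≢a b≡a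
  gain : ∀ {p q} → adj R₂.graph p q ≡ true → adj G p q ≡ true ⊎ Same a c p q ⊎ Same d b p q
  gain pq with R₂.gain pq
  ... | inj₂ s = inj₂ (inj₂ s)
  ... | inj₁ pq₁ with R₁.gain pq₁
  ...   | inj₂ s   = inj₂ (inj₁ s)
  ...   | inj₁ pq₀ = inj₁ pq₀
  loss : ∀ {p q} → adj G p q ≡ true → adj R₂.graph p q ≡ true ⊎ Same a b p q ⊎ Same d c p q
  loss pq with R₁.loss pq
  ... | inj₂ s = inj₂ (inj₁ s)
  ... | inj₁ pq₁ with R₂.loss pq₁
  ...   | inj₂ s   = inj₂ (inj₂ s)
  ...   | inj₁ pq₂ = inj₁ pq₂

switch : ∀ {n} (G : Graph n) {a b c d : Fin n} → adj G a b ≡ true → adj G c d ≡ true →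
  adj G a c ≡ false → adj G b d ≡ false → a ≢ c → a ≢ d → b ≢ c → b ≢ d → Switch G a b c d
switch G ab cd ac bd a≢c a≢d b≢c b≢d = compose ab a≢c a≢d R
  (rotate (Rotation.graph R) (trans (Rotation.off-centre R (a≢c ∘ sym) (a≢d ∘ sym)) cd)
          (trans (Rotation.off-centre R (adj⇒≢ G (adj-sym G ab)) (a≢d ∘ sym)) bd) (b≢d ∘ sym) (b≢c ∘ sym))
  where R = rotate G (adj-sym G ab) (adj-sym G ac) a≢c b≢c

infixl 6 _∖_
_∖_ : ∀ {n} → Graph n → Graph n → Graph n
A ∖ B = record
  { adj    = λ p q → adj A p q ∧ not (adj B p q)
  ; sym    = λ p q → cong₂ (λ a b → a ∧ not b) (Graph.sym A p q) (Graph.sym B p q)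
  ; irrefl = λ p → cong (_∧ not (adj B p p)) (irrefl A p)
  }

∖-intro : ∀ {n} (A B : Graph n) {p q} → adj A p q ≡ true → adj B p q ≡ false → adj (A ∖ B) p q ≡ true
∖-intro A B a b rewrite a | b = refl

∖-elim : ∀ {n} (A B : Graph n) {p q} → adj (A ∖ B) p q ≡ true → adj A p q ≡ true × adj B p q ≡ false
∖-elim A B {p} {q} pq with adj A p q | adj B p q
... | true | false = refl , refl

-- Both sides are the degree of `v` in the union of `A` and `B`.
deg-∖ : ∀ {n} (A B : Graph n) v → deg A v + deg (B ∖ A) v ≡ deg B v + deg (A ∖ B) v
deg-∖ A B v = trans (sym (∑-distrib-+ (𝟙 ∘ adj A v) (𝟙 ∘ adj (B ∖ A) v)))
  (trans (sum-cong-≗ (λ q → pointwise (adj A v q) (adj B v q))) (∑-distrib-+ (𝟙 ∘ adj B v) (𝟙 ∘ adj (A ∖ B) v)))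
  where
  pointwise : ∀ a b → 𝟙 a + 𝟙 (b ∧ not a) ≡ 𝟙 b + 𝟙 (a ∧ not b)
  pointwise true  true  = refl
  pointwise true  false = refl
  pointwise false true  = refl
  pointwise false false = refl

size : ∀ {n} → Graph n → ℕ
size G = sum (deg G)

size-mono-< : ∀ {n} (G H : Graph n) {u v} → (∀ {p q} → adj G p q ≡ true → adj H p q ≡ true) →
  adj G u v ≡ false → adj H u v ≡ true → size G < size H
size-mono-< G H {u} {v} G⊆H uv∉G uv∈H =
  sum-mono-< (λ p → sum-mono-≤ (pointwise p)) u (sum-mono-< (pointwise u) v strict)
  where
  pointwise : ∀ p q → 𝟙 (adj G p q) ≤ 𝟙 (adj H p q)
  pointwise p q with adj G p q in pq
  ... | false = z≤n
  ... | true rewrite G⊆H pq = ≤-refl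
  strict : 𝟙 (adj G u v) < 𝟙 (adj H u v)
  strict rewrite uv∉G | uv∈H = ≤-refl

neighbour : ∀ {n} (G : Graph n) {u} → 0 < deg G u → ∃ λ v → adj G u v ≡ true
neighbour G {u} 0<deg with sum-positive (𝟙 ∘ adj G u) 0<deg
... | v , 0<uv with adj G u v in uv
...   | true = v , uv

adj⇒deg>0 : ∀ {n} (G : Graph n) {u v} → adj G u v ≡ true → 0 < deg G u
adj⇒deg>0 G {u} {v} uv = ≤-trans (≤-reflexive (sym (cong 𝟙 uv))) (term≤sum (𝟙 ∘ adj G u) v)

module _ {n} (A B : Graph n) where

  record Improvement : Set where
    field
      A′ B′   : Graph n
      degA    : ∀ p → deg A′ p ≡ deg A p
      degB    : ∀ p → deg B′ p ≡ deg B p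
      smaller : size (B′ ∖ A′) < size (B ∖ A)

  ends-differ : ∀ {u v w} → adj (B ∖ A) u v ≡ true → adj (A ∖ B) u w ≡ true → v ≢ w
  ends-differ uv uw refl = true≢false (proj₁ (∖-elim A B uw)) (proj₂ (∖-elim B A uv))

  -- If wz is not in A, switch uw, vz to uv, wz in A; if it is in B, switch
  -- uv, wz to uw, vz in B.
  improve-along : ∀ {u v w z} → adj (B ∖ A) u v ≡ true → adj (A ∖ B) u w ≡ true → adj (A ∖ B) v z ≡ true →
    w ≢ z → adj (A ∖ B) w z ≡ false → Improvement
  improve-along {u} {v} {w} {z} uv uw vz w≢z wz with adj A w z in A-wz | adj B w z in B-wz
  ... | true | false = contradiction wz (λ ())
  ... | false | _ = record
    { A′ = S.graph ; B′ = B ; degA = S.deg≡ ; degB = λ _ → refl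
    ; smaller = size-mono-< (B ∖ S.graph) (B ∖ A) shrink (¬true⇒false gone) uv }
    where
    v≢w = ends-differ uv uw
    u≢z = ends-differ (adj-sym (B ∖ A) uv) vz
    module S = Switch (switch A (proj₁ (∖-elim A B uw)) (proj₁ (∖-elim A B vz)) (proj₂ (∖-elim B A uv)) A-wz
                              (adj⇒≢ (B ∖ A) uv) u≢z (v≢w ∘ sym) w≢z)
    -- The edges uw and vz that leave `A` are outside `B`, so none of them enters the difference.
    shrink : ∀ {p q} → adj (B ∖ S.graph) p q ≡ true → adj (B ∖ A) p q ≡ true
    shrink {p} {q} pq with ∖-elim B S.graph pq
    ... | B-pq , S-pq = ∖-intro B A B-pq (¬true⇒false absent)
      where
      absent : adj A p q ≢ true
      absent A-pq with S.loss A-pq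
      ... | inj₁ S-pq′ = true≢false S-pq′ S-pq
      ... | inj₂ (inj₁ s) = true≢false B-pq (trans (Same-adj B s) (proj₂ (∖-elim A B uw)))
      ... | inj₂ (inj₂ s) = true≢false B-pq (trans (Same-adj B s) (adj-sym B (proj₂ (∖-elim A B vz))))
    gone : adj (B ∖ S.graph) u v ≢ true
    gone uv′ = true≢false S.added (proj₂ (∖-elim B S.graph uv′))
  ... | true | true = record
    { A′ = A ; B′ = S.graph ; degA = λ _ → refl ; degB = S.deg≡
    ; smaller = size-mono-< (S.graph ∖ A) (B ∖ A) shrink (¬true⇒false gone) uv }
    where
    v≢w = ends-differ uv uw
    u≢z = ends-differ (adj-sym (B ∖ A) uv) vz
    module S = Switch (switch B (proj₁ (∖-elim B A uv)) B-wz (proj₂ (∖-elim A B uw)) (proj₂ (∖-elim A B vz))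
                              (adj⇒≢ (A ∖ B) uw) u≢z v≢w (adj⇒≢ (A ∖ B) vz))
    -- The edges uw and vz that enter `B` lie in `A`, so again the difference gains nothing.
    shrink : ∀ {p q} → adj (S.graph ∖ A) p q ≡ true → adj (B ∖ A) p q ≡ true
    shrink {p} {q} pq with ∖-elim S.graph A pq
    ... | S-pq , A-pq with S.gain S-pq
    ...   | inj₁ B-pq     = ∖-intro B A B-pq A-pq
    ...   | inj₂ (inj₁ s) = ⊥-elim (true≢false (trans (Same-adj A s) (proj₁ (∖-elim A B uw))) A-pq)
    ...   | inj₂ (inj₂ s) = ⊥-elim (true≢false (trans (Same-adj A s) (adj-sym A (proj₁ (∖-elim A B vz)))) A-pq)
    gone : adj (S.graph ∖ A) u v ≢ true
    gone uv′ = true≢false (proj₁ (∖-elim S.graph A uv′)) S.removed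

deg-∖-excess : ∀ {n} (A B : Graph n) k → (∀ v → deg A v ≡ deg B v + k) → ∀ v → deg (A ∖ B) v ≡ deg (B ∖ A) v + k
deg-∖-excess A B k A≡B+k v = +-cancelˡ-≡ (deg B v) _ _ (trans (sym (deg-∖ A B v)) (trans (cong (_+ deg (B ∖ A) v) (A≡B+k v)) (arith (deg B v) k (deg (B ∖ A) v))))
  where
  arith : ∀ b k x → b + k + x ≡ b + (x + k)
  arith = solve-∀

-- Take u of maximal degree in B ∖ A, hence also in A ∖ B, with uv ∈ B ∖ A and
-- vz ∈ A ∖ B. If A ∖ B contained wz for every other neighbour w of u, then z,
-- being also adjacent to v, would have larger degree than u.
improve-at : ∀ {n} (A B : Graph n) k → (∀ v → deg A v ≡ deg B v + k) →
  ∀ {u v z} → (∀ x → deg (B ∖ A) x ≤ deg (B ∖ A) u) → adj (B ∖ A) u v ≡ true → adj (A ∖ B) v z ≡ true →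
  Improvement A B
improve-at {n} A B k A≡B+k {u} {v} {z} u-max uv vz = finish (exchange-vertex D′ u≢z z<u)
  where
  excess : ∀ v → deg (A ∖ B) v ≡ deg (B ∖ A) v + k
  excess = deg-∖-excess A B k A≡B+k
  D = A ∖ B
  u≢v = adj⇒≢ (B ∖ A) uv
  v≢z = adj⇒≢ D vz
  u≢z : u ≢ z
  u≢z refl = true≢false (adj-sym A (proj₁ (∖-elim A B vz))) (proj₂ (∖-elim B A uv))
  uv∉D : adj D u v ≡ false
  uv∉D = ¬true⇒false (λ t → true≢false (proj₁ (∖-elim A B t)) (proj₂ (∖-elim B A uv)))
  -- In `D` the degree of `z` is only at most that of `u`. The artificial edge uv makes the
  -- comparison strict, and the vertex found cannot be `v`, since vz is in `D`.
  D′ = addEdge D u≢v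
  z<u : deg D′ z < deg D′ u
  z<u = begin-strict
    deg D′ z                          ≡⟨ deg-addEdge D u≢v uv∉D z ⟩
    deg D z + (δ u z + δ v z)         ≡⟨ cong₂ (λ a b → deg D z + (a + b)) (δ-≢ u≢z) (δ-≢ v≢z) ⟩
    deg D z + 0                       ≡⟨ +-identityʳ _ ⟩
    deg D z                           ≡⟨ excess z ⟩
    deg (B ∖ A) z + k                 ≤⟨ +-monoˡ-≤ k (u-max z) ⟩
    deg (B ∖ A) u + k                 ≡⟨ excess u ⟨
    deg D u                           <⟨ m<m+n (deg D u) z<s ⟩
    deg D u + (1 + 0)                 ≡⟨ cong₂ (λ a b → deg D u + (a + b)) (δ-refl u) (δ-≢ (u≢v ∘ sym)) ⟨
    deg D u + (δ u u + δ v u)         ≡⟨ deg-addEdge D u≢v uv∉D u ⟨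
    deg D′ u                          ∎
    where open ≤-Reasoning
  finish : (∃ λ w → adj D′ u w ≡ true × adj D′ z w ≡ false × w ≢ z) → Improvement A B
  finish (w , uw′ , zw′ , w≢z) = improve-along A B uv uw vz w≢z (adj-sym D zw)
    where
    zw : adj D z w ≡ false
    zw = trans (sym (setEdge-other true D u≢v
      λ { (inj₁ (u≡z , _)) → u≢z u≡z ; (inj₂ (_ , v≡z)) → v≢z v≡z })) zw′
    v≢w : v ≢ w
    v≢w refl = true≢false (adj-sym D vz) zw
    uw : adj D u w ≡ true
    uw = trans (sym (setEdge-other true D u≢v
      λ { (inj₁ (_ , v≡w)) → v≢w v≡w ; (inj₂ (_ , v≡u)) → u≢v (sym v≡u) })) uw′

improve : ∀ {m} (A B : Graph (suc m)) k → (∀ v → deg A v ≡ deg B v + k) →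
  ∀ {x y} → adj (B ∖ A) x y ≡ true → Improvement A B
improve A B k A≡B+k {x} xy =
  let u , u-max = argmax (deg (B ∖ A))
      v , uv    = neighbour (B ∖ A) (≤-trans (adj⇒deg>0 (B ∖ A) xy) (u-max x))
      z , vz    = neighbour (A ∖ B) (begin-strict
        0                   <⟨ adj⇒deg>0 (B ∖ A) (adj-sym (B ∖ A) uv) ⟩
        deg (B ∖ A) v       ≤⟨ m≤m+n _ k ⟩
        deg (B ∖ A) v + k   ≡⟨ deg-∖-excess A B k A≡B+k v ⟨
        deg (A ∖ B) v       ∎)
  in improve-at A B k A≡B+k u-max uv vz
  where open ≤-Reasoning

∖-subgraph : ∀ {n} (A B : Graph n) → SpanningSubgraph (A ∖ B) A
∖-subgraph A B u v with adj A u v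
... | true  = λ _ → _
... | false = λ ()

∖-regular : ∀ {n} (A B : Graph n) k → (∀ v → deg A v ≡ deg B v + k) →
  (∀ u v → adj (B ∖ A) u v ≡ false) → ∀ v → deg (A ∖ B) v ≡ k
∖-regular {n} A B k A≡B+k empty v = trans (deg-∖-excess A B k A≡B+k v) (cong (_+ k) (begin
  deg (B ∖ A) v       ≡⟨ sum-cong-≗ (cong 𝟙 ∘ empty v) ⟩
  sum {n} (λ _ → 0)   ≡⟨ sum-const n 0 ⟩
  n * 0               ≡⟨ *-zeroʳ n ⟩
  0                   ∎))
  where open ≡-Reasoning

empty-or-edge : ∀ {n} (G : Graph n) → (∀ u v → adj G u v ≡ false) ⊎ ∃₂ λ u v → adj G u v ≡ true
empty-or-edge G with Fin.any? (λ x → Fin.any? (λ y → adj G x y ≟ᵇ true))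
... | yes edge = inj₂ edge
... | no none  = inj₁ (λ u v → ¬true⇒false (λ uv → none (u , v , uv)))

kundu : ∀ {m} (A B : Graph (suc m)) k → (∀ v → deg A v ≡ deg B v + k) →
  ∃ λ G → (∀ v → deg G v ≡ deg A v) × HasFactor k G
kundu A B k A≡B+k = go A B A≡B+k (<-wellFounded (size (B ∖ A)))
  where
  go : ∀ A B → (∀ v → deg A v ≡ deg B v + k) → Acc _<_ (size (B ∖ A)) →
    ∃ λ G → (∀ v → deg G v ≡ deg A v) × HasFactor k G
  step : ∀ A B → (∀ v → deg A v ≡ deg B v + k) → Acc _<_ (size (B ∖ A)) → Improvement A B →
    ∃ λ G → (∀ v → deg G v ≡ deg A v) × HasFactor k G
  go A B A≡B+k rec with empty-or-edge (B ∖ A)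
  ... | inj₁ empty = A , (λ _ → refl) , A ∖ B , ∖-subgraph A B ,
                     λ v → trans (degree≡deg (A ∖ B) v) (∖-regular A B k A≡B+k empty v)
  ... | inj₂ (_ , _ , xy) = step A B A≡B+k rec (improve A B k A≡B+k xy)
  step A B A≡B+k (acc rec) I =
    let G , G≡A′ , factor = go A′ B′ (λ v → trans (degA v) (trans (A≡B+k v) (cong (_+ k) (sym (degB v))))) (rec smaller)
    in G , (λ v → trans (G≡A′ v) (degA v)) , factor
    where open Improvement I

-- The Erdős-Gallai inequalities after subtracting k.

deg<n : ∀ {n} (G : Graph n) v → deg G v < n
deg<n {n} G v = begin
  1 + deg G v                            ≡⟨ +-comm 1 (deg G v) ⟩
  deg G v + 1                            ≡⟨ cong (deg G v +_) (sum-δ v) ⟨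
  deg G v + sum (δ v)                    ≡⟨ ∑-distrib-+ (𝟙 ∘ adj G v) (δ v) ⟨
  sum (λ u → 𝟙 (adj G v u) + δ v u)      ≤⟨ sum-mono-≤ pointwise ⟩
  sum {n} (λ _ → 1)                      ≡⟨ trans (sum-const n 1) (*-identityʳ n) ⟩
  n                                      ∎
  where
  open ≤-Reasoning
  pointwise : ∀ u → 𝟙 (adj G v u) + δ v u ≤ 1
  pointwise u with v Fin.≟ u
  ... | yes refl rewrite irrefl G v = ≤-refl
  ... | no _ with adj G v u
  ...   | true  = ≤-refl
  ...   | false = z≤n

2∣n*n+n : ∀ n → 2 ∣ n * n + n
2∣n*n+n zero    = divides 0 refl
2∣n*n+n (suc n) = subst (2 ∣_) (arith n) (∣m∣n⇒∣m+n (2∣n*n+n n) (m∣m*n (suc n)))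
  where
  arith : ∀ n → n * n + n + 2 * (1 + n) ≡ (1 + n) * (1 + n) + (1 + n)
  arith = solve-∀

-- In the application e = d - k, `c` is its least value and r = d₁ - dₙ, so that c + r is its
-- largest. `middle` is the hypothesis of the theorem at the index `r`, counted from 0, carried over
-- to the earlier positions.
module _ {n} (e : Fin n → ℕ) (e-mono : ∀ {i j} → toℕ i ≤ toℕ j → e j ≤ e i)
         (e-even : 2 ∣ sum e) (k c r : ℕ) (c≤e : ∀ i → c ≤ e i) (e≤c+r : ∀ i → e i ≤ c + r)
         (c+r<n : c + r < n) (middle : ∀ i → toℕ i ≤ r → r ≤ e i + 1)
         (shifted-eg : ∀ t → t ≤ n → ErdősGallai (λ i → e i + k) t) where

  module _ (t : ℕ) (t≤n : t ≤ n) where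

    low-sum : sum (λ i → lo t i * e i) ≤ t * (c + r)
    low-sum = begin
      sum (λ i → lo t i * e i)            ≤⟨ sum-mono-≤ (λ i → *-monoʳ-≤ (lo t i) (e≤c+r i)) ⟩
      sum (λ i → lo {n} t i * (c + r))    ≡⟨ *-distribʳ-sum (c + r) (lo {n} t) ⟨
      sum (lo {n} t) * (c + r)            ≡⟨ cong (_* (c + r)) (sum-lo t t≤n) ⟩
      t * (c + r)                         ∎
      where open ≤-Reasoning

    high-sum = sum (λ i → hi t i * (t ⊓ e i))

    -- Every later term equals `t`, so the right side is tn, while the left side is at most t(c + r
    -- + 1).
    eg-small : t ≤ c → ErdősGallai e t
    eg-small t≤c = begin
      sum (λ i → lo t i * e i) + t      ≤⟨ +-monoˡ-≤ t low-sum ⟩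
      t * (c + r) + t                   ≡⟨ arith₁ t (c + r) ⟩
      t * suc (c + r)                   ≤⟨ *-monoʳ-≤ t c+r<n ⟩
      t * n                             ≡⟨ cong (t *_) (sum-hi t t≤n) ⟨
      t * (t + sum {n} (hi t))          ≡⟨ arith₂ t (sum {n} (hi t)) ⟩
      t * t + sum {n} (hi t) * t        ≡⟨ cong (t * t +_) (*-distribʳ-sum t (hi {n} t)) ⟩
      t * t + sum (λ i → hi {n} t i * t) ≤⟨ +-monoʳ-≤ (t * t) (sum-mono-≤ (λ i → *-monoʳ-≤ (hi t i) (⊓-glb ≤-refl (≤-trans t≤c (c≤e i))))) ⟩
      t * t + high-sum                  ∎
      where
      open ≤-Reasoning
      arith₁ : ∀ t x → t * x + t ≡ t * (1 + x)
      arith₁ = solve-∀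
      arith₂ : ∀ t h → t * (t + h) ≡ t * t + h * t
      arith₂ = solve-∀

    module _ (s : ℕ) (t≤s : t ≤ s) (s≤n : s ≤ n) (large : ∀ i → t ≤ toℕ i → toℕ i < s → t ≤ e i) where

      -- Subtracting k lowers the left side by t k, and the right side by at most
      -- (n − s) k, as the terms between t and s already equal t.
      eg-by-shift : n ≤ s + t → ErdősGallai e t
      eg-by-shift n≤s+t = +-cancelʳ-≤ (t * k) _ _ (begin
        L + t + t * k                                         ≡⟨ arith L t k ⟩
        (L + t * k) + t                                       ≡⟨ cong (λ x → (L + x * k) + t) (sum-lo t t≤n) ⟨
        (L + sum {n} (lo t) * k) + t                          ≡⟨ cong (λ x → (L + x) + t) (*-distribʳ-sum k (lo {n} t)) ⟩
        (L + sum (λ i → lo {n} t i * k)) + t                  ≡⟨ cong (_+ t) (∑-distrib-+ (λ i → lo t i * e i) (λ i → lo t i * k)) ⟨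
        sum (λ i → lo t i * e i + lo t i * k) + t             ≡⟨ cong (_+ t) (sum-cong-≗ (λ i → *-distribˡ-+ (lo t i) (e i) k)) ⟨
        sum (λ i → lo t i * (e i + k)) + t                    ≤⟨ shifted-eg t t≤n ⟩
        t * t + sum (λ i → hi t i * (t ⊓ (e i + k)))          ≤⟨ +-monoʳ-≤ (t * t) (sum-mono-≤ pointwise) ⟩
        t * t + sum (λ i → hi t i * (t ⊓ e i) + hi s i * k)   ≡⟨ cong (t * t +_) (∑-distrib-+ (λ i → hi t i * (t ⊓ e i)) (λ i → hi s i * k)) ⟩
        t * t + (high-sum + sum (λ i → hi {n} s i * k))       ≡⟨ cong (λ x → t * t + (high-sum + x)) (*-distribʳ-sum k (hi {n} s)) ⟨
        t * t + (high-sum + sum {n} (hi s) * k)               ≤⟨ +-monoʳ-≤ (t * t) (+-monoʳ-≤ high-sum (*-monoˡ-≤ k N≤t)) ⟩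
        t * t + (high-sum + t * k)                            ≡⟨ +-assoc (t * t) high-sum (t * k) ⟨
        t * t + high-sum + t * k                              ∎)
        where
        open ≤-Reasoning
        L = sum (λ i → lo t i * e i)
        arith : ∀ l t k → l + t + t * k ≡ (l + t * k) + t
        arith = solve-∀
        N≤t : sum {n} (hi s) ≤ t
        N≤t = +-cancelˡ-≤ s _ _ (≤-trans (≤-reflexive (sum-hi s s≤n)) n≤s+t)
        pointwise : ∀ i → hi t i * (t ⊓ (e i + k)) ≤ hi t i * (t ⊓ e i) + hi s i * k
        pointwise i with position t i | position s i
        ... | below _ _ hi≡0 | _ rewrite hi≡0 = z≤n
        ... | above t≤i _ hi≡1 | below i<s _ hi≡0 rewrite hi≡1 | hi≡0 | +-identityʳ ((t ⊓ e i) + 0)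
                | m≤n⇒m⊓n≡m (large i t≤i i<s) = +-monoˡ-≤ 0 (m⊓n≤m t _)
        ... | above _ _ hi≡1 | above _ _ hi≡1′ rewrite hi≡1 | hi≡1′ | +-identityʳ k
                | +-identityʳ (t ⊓ (e i + k)) | +-identityʳ (t ⊓ e i) = begin
          t ⊓ (e i + k)         ≤⟨ ⊓-monoˡ-≤ (e i + k) (m≤m+n t k) ⟩
          (t + k) ⊓ (e i + k)   ≡⟨ +-distribʳ-⊓ k t (e i) ⟨
          (t ⊓ e i) + k         ∎

      -- The terms between `t` and `s` equal `t` and those from `s` on are at least `c`. Against t(c
      -- + r + 1) on the left, the surplus is at least t(s - r - 1) + c(n - s - t). Adding `N * t`
      -- to both sides avoids subtraction.
      eg-by-counting : c ≤ t → r < s → s + t ≤ n → ErdősGallai e t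
      eg-by-counting c≤t r<s s+t≤n = +-cancelʳ-≤ (N * t) _ _ (begin
        sum (λ i → lo t i * e i) + t + N * t          ≤⟨ +-monoˡ-≤ (N * t) (+-monoˡ-≤ t low-sum) ⟩
        t * (c + r) + t + N * t                       ≡⟨ arith₁ t c r N ⟩
        suc r * t + N * t + t * c                     ≤⟨ +-mono-≤ (+-monoˡ-≤ (N * t) (*-monoˡ-≤ t r<s)) (*-monoˡ-≤ c t≤N) ⟩
        s * t + N * t + N * c                         ≡⟨ cong (_+ N * c) (*-distribʳ-+ t s N) ⟨
        (s + N) * t + N * c                           ≡⟨ cong (λ x → x * t + N * c) (trans (sum-hi s s≤n) (sym (sum-hi t t≤n))) ⟩
        (t + M) * t + N * c                           ≡⟨ arith₂ t M N c ⟩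
        t * t + (M * t + N * c)                       ≡⟨ cong (t * t +_) (cong₂ _+_ (*-distribʳ-sum t (hi {n} t)) (*-distribʳ-sum c (hi {n} s))) ⟩
        t * t + (sum (λ i → hi {n} t i * t) + sum (λ i → hi {n} s i * c)) ≡⟨ cong (t * t +_) (∑-distrib-+ (λ i → hi {n} t i * t) (λ i → hi s i * c)) ⟨
        t * t + sum (λ i → hi {n} t i * t + hi s i * c) ≤⟨ +-monoʳ-≤ (t * t) (sum-mono-≤ pointwise) ⟩
        t * t + sum (λ i → hi t i * (t ⊓ e i) + hi s i * t) ≡⟨ cong (t * t +_) (∑-distrib-+ (λ i → hi t i * (t ⊓ e i)) (λ i → hi s i * t)) ⟩
        t * t + (high-sum + sum (λ i → hi {n} s i * t)) ≡⟨ cong (λ x → t * t + (high-sum + x)) (*-distribʳ-sum t (hi {n} s)) ⟨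
        t * t + (high-sum + N * t)                    ≡⟨ +-assoc (t * t) high-sum (N * t) ⟨
        t * t + high-sum + N * t                      ∎)
        where
        open ≤-Reasoning
        M = sum {n} (hi t)
        N = sum {n} (hi s)
        arith₁ : ∀ t c r N → t * (c + r) + t + N * t ≡ (1 + r) * t + N * t + t * c
        arith₁ = solve-∀
        arith₂ : ∀ t M N c → (t + M) * t + N * c ≡ t * t + (M * t + N * c)
        arith₂ = solve-∀
        t≤N : t ≤ N
        t≤N = +-cancelˡ-≤ s _ _ (≤-trans s+t≤n (≤-reflexive (sym (sum-hi s s≤n))))
        pointwise : ∀ i → hi t i * t + hi s i * c ≤ hi t i * (t ⊓ e i) + hi s i * t
        pointwise i with position t i | position s i
        ... | below _ _ hi≡0 | below _ _ hi≡0′ rewrite hi≡0 | hi≡0′ = z≤n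
        ... | below i<t _ _ | above s≤i _ _ = contradiction (≤-trans t≤s s≤i) (<⇒≱ i<t)
        ... | above t≤i _ hi≡1 | below i<s _ hi≡0 rewrite hi≡1 | hi≡0 | m≤n⇒m⊓n≡m (large i t≤i i<s) = ≤-refl
        ... | above _ _ hi≡1 | above _ _ hi≡1′ rewrite hi≡1 | hi≡1′ | +-identityʳ t | +-identityʳ c | +-identityʳ (t ⊓ e i) =
          ≤-trans (≤-reflexive (+-comm t c)) (+-monoˡ-≤ t (⊓-glb c≤t (c≤e i)))

      eg-between : c ≤ t → r < s → ErdősGallai e t
      eg-between c≤t r<s with ≤-total n (s + t)
      ... | inj₁ n≤s+t = eg-by-shift n≤s+t
      ... | inj₂ s+t≤n = eg-by-counting c≤t r<s s+t≤n

  r<n : r < n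
  r<n = ≤-<-trans (m≤n+m r c) c+r<n

  -- Here counting falls short by one, and a failure of the inequality would
  -- force e to have the odd sum r² + r + 2rc − 1.
  eg-critical : ∀ ρ → toℕ ρ ≡ r → e ρ + 1 ≡ r → suc r + r ≤ n → ErdősGallai e r
  eg-critical ρ ρ≡r eρ+1≡r 2r<n = ≮⇒≥ λ fail → contradiction (∣1⇒≡1 (∣m+n∣m⇒∣n (even-suc fail) e-even)) λ ()
    where
    L = sum (λ i → lo r i * e i)
    H = sum (λ i → hi r i * e i)
    N = sum {n} (hi (suc r))
    r≤N : r ≤ N
    r≤N = +-cancelˡ-≤ (suc r) _ _ (≤-trans 2r<n (≤-reflexive (sym (sum-hi (suc r) r<n))))
    e<r : ∀ i → r ≤ toℕ i → e i < r
    e<r i r≤i = ≤-trans (s≤s (e-mono (≤-trans (≤-reflexive ρ≡r) r≤i))) (≤-reflexive (trans (+-comm 1 _) eρ+1≡r))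
    high-sum≡H : sum (λ i → hi r i * (r ⊓ e i)) ≡ H
    high-sum≡H = sum-cong-≗ pointwise
      where
      pointwise : ∀ i → hi r i * (r ⊓ e i) ≡ hi r i * e i
      pointwise i with position r i
      ... | below _ _ hi≡0 rewrite hi≡0 = refl
      ... | above r≤i _ _ = cong (hi r i *_) (m≥n⇒m⊓n≡n (<⇒≤ (e<r i r≤i)))
    pointwise : ∀ i → δ ρ i * r + hi (suc r) i * c ≤ hi r i * e i + δ ρ i
    pointwise i with ρ Fin.≟ i | position r i | position (suc r) i
    ... | yes refl | below ρ<r _ _ | _ = contradiction ρ≡r (<⇒≢ ρ<r)
    ... | yes refl | above _ _ _ | above r<ρ _ _ = contradiction (sym ρ≡r) (<⇒≢ r<ρ)
    ... | yes refl | above _ _ hi≡1 | below _ _ hi≡0 rewrite hi≡1 | hi≡0 | +-identityʳ (e ρ) =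
          ≤-reflexive (trans (+-identityʳ _) (trans (+-identityʳ r) (sym eρ+1≡r)))
    ... | no _ | below i<r _ _ | above r<i _ _ = contradiction (<-trans i<r r<i) (<-irrefl refl)
    ... | no _ | below _ _ _ | below _ _ hi≡0 rewrite hi≡0 = z≤n
    ... | no ρ≢i | above r≤i _ _ | below (s≤s i≤r) _ _ =
          contradiction (Fin.toℕ-injective (trans ρ≡r (≤-antisym r≤i i≤r))) ρ≢i
    ... | no _ | above _ _ hi≡1 | above _ _ hi≡1′ rewrite hi≡1 | hi≡1′ | +-identityʳ c | +-identityʳ (e i) | +-identityʳ (e i) = c≤e i
    -- Position `r` contributes exactly r - 1, and each of the N ≥ r later positions at least `c`.
    H-bound : r + r * c ≤ H + 1
    H-bound = begin
      r + r * c                                         ≤⟨ +-monoʳ-≤ r (*-monoˡ-≤ c r≤N) ⟩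
      r + N * c                                         ≡⟨ cong₂ _+_ (trans (cong (_* r) (sum-δ ρ)) (*-identityˡ r)) refl ⟨
      sum (δ ρ) * r + N * c                             ≡⟨ cong₂ _+_ (*-distribʳ-sum r (δ ρ)) (*-distribʳ-sum c (hi {n} (suc r))) ⟩
      sum (λ i → δ ρ i * r) + sum (λ i → hi {n} (suc r) i * c) ≡⟨ ∑-distrib-+ (λ i → δ ρ i * r) (λ i → hi (suc r) i * c) ⟨
      sum (λ i → δ ρ i * r + hi (suc r) i * c)          ≤⟨ sum-mono-≤ pointwise ⟩
      sum (λ i → hi r i * e i + δ ρ i)                  ≡⟨ ∑-distrib-+ (λ i → hi r i * e i) (δ ρ) ⟩
      H + sum (δ ρ)                                     ≡⟨ cong (H +_) (sum-δ ρ) ⟩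
      H + 1                                             ∎
      where open ≤-Reasoning
    L-bound : L ≤ r * (c + r)
    L-bound = low-sum r (<⇒≤ r<n)
    -- A failure leaves no slack in `L-bound` and `H-bound`: both become equalities, which
    -- determines the sum of `e`.
    even-suc : r * r + sum (λ i → hi r i * (r ⊓ e i)) < L + r → 2 ∣ sum e + 1
    even-suc fail = subst (2 ∣_) (sym total) (∣m∣n⇒∣m+n (2∣n*n+n r) (m∣m*n (r * c)))
      where
      fail′ : r * r + (H + 1) ≤ L + r
      fail′ = ≤-trans (≤-reflexive (trans (sym (+-assoc (r * r) H 1)) (+-comm (r * r + H) 1)))
                      (subst (λ x → r * r + x < L + r) high-sum≡H fail)
      arith₁ : ∀ r c → r * (c + r) + r ≡ r * r + (r + r * c)
      arith₁ = solve-∀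
      arith₂ : ∀ r c → r * (c + r) + (r + r * c) ≡ r * r + r + 2 * (r * c)
      arith₂ = solve-∀
      open ≤-Reasoning
      H≡ : H + 1 ≡ r + r * c
      H≡ = ≤-antisym (+-cancelˡ-≤ (r * r) _ _ (begin
        r * r + (H + 1)         ≤⟨ fail′ ⟩
        L + r                   ≤⟨ +-monoˡ-≤ r L-bound ⟩
        r * (c + r) + r         ≡⟨ arith₁ r c ⟩
        r * r + (r + r * c)     ∎)) H-bound
      L≡ : L ≡ r * (c + r)
      L≡ = ≤-antisym L-bound (+-cancelʳ-≤ r _ _ (begin
        r * (c + r) + r         ≡⟨ arith₁ r c ⟩
        r * r + (r + r * c)     ≤⟨ +-monoʳ-≤ (r * r) H-bound ⟩
        r * r + (H + 1)         ≤⟨ fail′ ⟩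
        L + r                   ∎))
      total : sum e + 1 ≡ r * r + r + 2 * (r * c)
      total = begin-equality
        sum e + 1                     ≡⟨ cong (_+ 1) (sum-lo+hi r e) ⟨
        L + H + 1                     ≡⟨ +-assoc L H 1 ⟩
        L + (H + 1)                   ≡⟨ cong₂ _+_ L≡ H≡ ⟩
        r * (c + r) + (r + r * c)     ≡⟨ arith₂ r c ⟩
        r * r + r + 2 * (r * c)       ∎

  -- The work lies in the choice of the threshold `s`: counting requires r < s, and all values from
  -- `t` up to `s` must be at least `t`.
  erdős-gallai-unshift : ∀ t → t ≤ n → ErdősGallai e t
  erdős-gallai-unshift t t≤n with t ≤? c | r <? t
  ... | yes t≤c | _       = eg-small t t≤n t≤c
  -- With s = t the range between them is empty.
  ... | no t≰c  | yes r<t = eg-between t t≤n t ≤-refl t≤n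
        (λ i t≤i i<t → contradiction t≤i (<⇒≱ i<t)) (<⇒≤ (≰⇒> t≰c)) r<t
  ... | no t≰c  | no r≮t with t ≟ r
  -- For t < r the first r + 1 values are at least r - 1 ≥ t, so s = r + 1 is admissible.
  ...   | no t≢r = eg-between t t≤n (suc r) (m≤n⇒m≤1+n (≮⇒≥ r≮t)) r<n
          (λ { i _ (s≤s i≤r) → +-cancelʳ-≤ 1 _ _ (≤-trans (≤-reflexive (+-comm t 1)) (≤-trans (≤∧≢⇒< (≮⇒≥ r≮t) t≢r) (middle i i≤r))) })
          (<⇒≤ (≰⇒> t≰c)) (n<1+n r)
  ...   | yes refl with r ≤? e (fromℕ< r<n) | n ≤? r + r
  ...     | yes r≤eρ | _ = eg-between r t≤n (suc r) (n≤1+n r) r<n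
            (λ { i _ (s≤s i≤r) → ≤-trans r≤eρ (e-mono (≤-trans i≤r (≤-reflexive (sym (Fin.toℕ-fromℕ< r<n))))) })
            (<⇒≤ (≰⇒> t≰c)) (n<1+n r)
  -- The value at position `r` is below `r`, so `s` must retreat to `r`; shifting still works there,
  -- but counting does not.
  ...     | no _    | yes n≤2r = eg-by-shift r t≤n r ≤-refl t≤n (λ i r≤i i<r → contradiction r≤i (<⇒≱ i<r)) n≤2r
  ...     | no r≰eρ | no n≰2r  = eg-critical (fromℕ< r<n) (Fin.toℕ-fromℕ< r<n)
            (≤-antisym (≤-trans (≤-reflexive (+-comm _ 1)) (≰⇒> r≰eρ)) (middle (fromℕ< r<n) (≤-reflexive (Fin.toℕ-fromℕ< r<n))))
            (≰⇒> n≰2r)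

-- Positions are counted from 0, so the position d₁ - dₙ + 1 has index d₁ - dₙ. The - 1 of the
-- hypothesis stands as + 1 on the other side, out of reach of truncated subtraction.
theorem5 : (m : ℕ) (d : Fin (suc m) → ℕ) (k : ℕ) →
    NonIncreasing d →
    Graphic d →
    k ≤ d (fromℕ m) →
    2 ∣ (k * suc m) →
    (∀ (i : Fin (suc m)) → toℕ i ≡ d zero ∸ d (fromℕ m) →
    d i + 1 ≥ (d zero ∸ d (fromℕ m)) + k) →
    Σ (Graph (suc m)) λ G → Realizes G d × HasFactor k G
theorem5 m d k d-mono (A , A-realizes) k≤dₙ kn-even middle =
  let B , B≡e = erdős-gallai-sufficient e e-mono e-even
                  (erdős-gallai-unshift e e-mono e-even k c r c≤e e≤c+r c+r<n e-middle shifted-eg)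
      G , G≡A , factor = kundu A B k λ v → trans (A≡d v) (trans (sym (e+k v)) (cong (_+ k) (sym (B≡e v))))
  in G , (λ v → trans (degree≡deg G v) (trans (G≡A v) (A≡d v))) , factor
  where
  last = fromℕ m
  n = suc m
  e : Fin n → ℕ
  e i = d i ∸ k
  c r : ℕ
  c = e last
  r = d zero ∸ d last
  d-last : ∀ i → d last ≤ d i
  d-last i = d-mono i last (Fin.≤fromℕ i)
  A≡d : ∀ v → deg A v ≡ d v
  A≡d v = trans (sym (degree≡deg A v)) (A-realizes v)
  e+k : ∀ i → e i + k ≡ d i
  e+k i = m∸n+n≡m (≤-trans k≤dₙ (d-last i))
  e-mono : ∀ {i j} → toℕ i ≤ toℕ j → e j ≤ e i
  e-mono i≤j = ∸-monoˡ-≤ k (d-mono _ _ i≤j)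
  c≤e : ∀ i → c ≤ e i
  c≤e i = ∸-monoˡ-≤ k (d-last i)
  c+r+k≡d₁ : c + r + k ≡ d zero
  c+r+k≡d₁ = trans (shuffle c r k) (trans (cong (_+ r) (e+k last)) (m+[n∸m]≡n (d-last zero)))
    where
    shuffle : ∀ c r k → c + r + k ≡ c + k + r
    shuffle = solve-∀
  e≤c+r : ∀ i → e i ≤ c + r
  e≤c+r i = +-cancelʳ-≤ k _ _ (≤-trans (≤-reflexive (e+k i)) (≤-trans (d-mono zero i z≤n) (≤-reflexive (sym c+r+k≡d₁))))
  c+r<n : c + r < n
  c+r<n = ≤-<-trans (≤-trans (m≤m+n (c + r) k) (≤-reflexive (trans c+r+k≡d₁ (sym (A≡d zero))))) (deg<n A zero)
  e-middle : ∀ i → toℕ i ≤ r → r ≤ e i + 1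
  e-middle i i≤r = +-cancelʳ-≤ k _ _ (begin
    r + k             ≤⟨ middle ρ ρ≡r ⟩
    d ρ + 1           ≤⟨ +-monoˡ-≤ 1 (d-mono i ρ (≤-trans i≤r (≤-reflexive (sym ρ≡r)))) ⟩
    d i + 1           ≡⟨ cong (_+ 1) (e+k i) ⟨
    e i + k + 1       ≡⟨ shuffle (e i) k ⟩
    e i + 1 + k       ∎)
    where
    open ≤-Reasoning
    shuffle : ∀ x k → x + k + 1 ≡ x + 1 + k
    shuffle = solve-∀
    -- The hypothesis speaks of positions whose index is `r`; one exists because r ≤ d₁ < n.
    r<n′ : r < n
    r<n′ = ≤-<-trans (m≤n+m r c) c+r<n
    ρ = fromℕ< r<n′
    ρ≡r : toℕ ρ ≡ r
    ρ≡r = Fin.toℕ-fromℕ< r<n′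
  e-even : 2 ∣ sum e
  e-even = ∣m+n∣m⇒∣n (subst (2 ∣_) total (handshake A)) kn-even
    where
    total : sum (deg A) ≡ k * n + sum e
    total = begin
      sum (deg A)                     ≡⟨ sum-cong-≗ (λ v → trans (A≡d v) (sym (e+k v))) ⟩
      sum (λ v → e v + k)             ≡⟨ ∑-distrib-+ e (λ _ → k) ⟩
      sum e + sum {n} (λ _ → k)       ≡⟨ cong (sum e +_) (trans (sum-const n k) (*-comm n k)) ⟩
      sum e + k * n                   ≡⟨ +-comm (sum e) (k * n) ⟩
      k * n + sum e                   ∎
      where open ≡-Reasoning
  shifted-eg : ∀ t → t ≤ n → ErdősGallai (λ i → e i + k) t
  shifted-eg t t≤n = subst₂ _≤_
    (cong (_+ t) (sum-cong-≗ λ i → cong (lo t i *_) (deg≡ i)))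
    (cong (t * t +_) (sum-cong-≗ λ i → cong (λ x → hi t i * (t ⊓ x)) (deg≡ i)))
    (erdős-gallai-necessary A t t≤n)
    where
    deg≡ : ∀ i → deg A i ≡ e i + k
    deg≡ i = trans (A≡d i) (sym (e+k i))
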